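{- Let $\lambda\in\{2,3\}$ and let $n,m_0\in\mathbb{N}$ be such that there exists a $\lambda$-edge-connected path-complete graph of order $n$ and size at least $m_0$; let $PK^{\lambda}_{n,m_0}$ be such a graph of minimum size. Let $D$ be a $\lambda$-edge-connected Eulerian digraph of order $n$ and size at least $2m_0$. Then $$\rho(D)\le\rho(\overleftrightarrow{PK^{\lambda}_{n,m_0}}).$$ This bound is sharp, i.e. it is attained by some $\lambda$-edge-connected Eulerian digraph of order $n$ and size at least $2m_0$.
   Context: Graphs and digraphs are finite, without loops or multiple edges/arcs (opposite arcs are allowed). $\mathbb{N}$ denotes the positive integers. Order is the number of vertices; size is the number of edges of a graph, respectively arcs of a digraph. A digraph is strong if there is a directed path between every ordered pair of vertices. An Eulerian digraph is a strong digraph that contains an Eulerian circuit (a closed directed trail using every arc). The edge-connectivity of a digraph is the minimum number of arcs that must be removed to make it not strong; a digraph is $\lambda$-edge-connected if its edge-connectivity is at least $\lambda$. For a strong digraph $D$ of order $n\ge2$, the remoteness is $\rho(D)=\max_{v\in V(D)}\frac{1}{n-1}\sum_{w\in V(D)}d_D(v,w)$, where $d_D(v,w)$ is the length of a shortest directed path from $v$ to $w$. For a graph $G$, $\overleftrightarrow{G}$ is the digraph obtained by replacing each edge by two arcs in opposite directions. For disjoint graphs $G_1,\ldots,G_k$, the sequential sum $G_1+\cdots+G_k$ is obtained from their union by joining every vertex of $G_i$ to every vertex of $G_{i+1}$, $i=1,\ldots,k-1$. The notation $[K_1+K_\lambda]^k$ stands for $k$ consecutive repetitions of the pattern $K_1+K_\lambda$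 in a sequential sum. For $\lambda\in\{2,3\}$, a $\lambda$-edge-connected path-complete graph is a graph $G$ for which there exist $k\in\mathbb{N}\cup\{0\}$ and $a,b\in\mathbb{N}$ such that one of the following holds: (i) $G=[K_1+K_\lambda]^k+K_a+K_b$ with $k\ge1$ and $ab\ge\lambda$; (ii) $G=[K_1+K_\lambda]^k+K_1+K_a+K_b$ with $a\ge\lambda$; (iii) $\lambda=3$ and $G=[K_1+K_3]^k+K_2+K_a+K_1$ with $k\ge1$ and $a\ge3$. -}

module Defs where

open import Algebra.Properties.CommutativeMonoid.Sum using () renaming (sum to sumOver)
open import Data.Fin.Base using (Fin; toℕ)
import Data.Fin.Properties as Fin
open import Data.Integer.Base using (+_)
open import Data.List.Base as List using (List; []; _∷_; _++_; concat; replicate; length; allFin)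
import Data.List.Extrema as Extrema
open import Data.Nat.Base
  using (ℕ; zero; suc; pred; _*_; _≤_; z≤n; s≤s; NonZero; NonTrivial)
import Data.Nat.Properties as ℕ
open import Data.Product.Base using (Σ; Σ-syntax; ∃; ∃-syntax; _×_; _,_; proj₁; proj₂)
import Data.Rational.Base as ℚ
import Data.Rational.Properties as ℚ
open import Data.Vec.Base using (Vec; []; _∷_; head; tail; init; last; zip)
open import Data.Vec.Membership.Propositional using (_∈_)
open import Data.Vec.Relation.Unary.Linked using (Linked; linked?)
open import Data.Vec.Relation.Unary.AllPairs using (allPairs?)
open import Data.Vec.Relation.Unary.Unique.Propositional using (Unique)
open import Data.Bool.Base using (if_then_else_)
open import Function.Bundles using (_↔_; _⇔_; Inverse)
open import Level using (0ℓ)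
open import Relation.Binary.Bundles using (DecTotalOrder)
open import Relation.Binary.Core using (Rel)
open import Relation.Binary.Definitions using (Decidable; Symmetric; Irreflexive)
open import Relation.Binary.PropositionalEquality using (_≡_; _≢_; refl; sym; ≢-sym)
open import Relation.Nullary.Decidable using (Dec; yes; no; does; map′; ¬?; _×-dec_)
open import Relation.Nullary.Negation using (¬_; contradiction)
import Relation.Unary as U

record Digraph (V : Set) : Set₁ where
  field
    Arc    : Rel V 0ℓ
    arc?   : Decidable Arc
    irrefl : Irreflexive _≡_ Arc

open Digraph public using (Arc; arc?)

record Graph (V : Set) : Set₁ where
  field
    Adj     : Rel V 0ℓ
    adj?    : Decidable Adj
    irrefl  : Irreflexive _≡_ Adj
    adj-sym : Symmetric Adj

open Graph public using (Adj; adj?)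

∑ : ∀ {n} → (Fin n → ℕ) → ℕ
∑ = sumOver ℕ.+-0-commutativeMonoid

𝟙 : ∀ {A : Set} → Dec A → ℕ
𝟙 a? = if does a? then 1 else 0

size : ∀ {n} → Digraph (Fin n) → ℕ
size D = ∑ λ u → ∑ λ v → 𝟙 (arc? D u v)

-- Each edge is counted once, at its ordered pair u < v.
graphSize : ∀ {n} → Graph (Fin n) → ℕ
graphSize G = ∑ λ u → ∑ λ v → 𝟙 ((u Fin.<? v) ×-dec adj? G u v)

bidirected : ∀ {V} → Graph V → Digraph V
bidirected G = record { Arc = Adj G ; arc? = adj? G ; irrefl = Graph.irrefl G }

-- A sequence of k + 1 vertices is a walk (path) of length k.

IsWalk : ∀ {V k} → Digraph V → V → V → Vec V (suc k) → Set
IsWalk D u v ws = Linked (Arc D) ws × head ws ≡ u × last ws ≡ v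

IsPath : ∀ {V k} → Digraph V → V → V → Vec V (suc k) → Set
IsPath D u v ws = IsWalk D u v ws × Unique ws

HasPath : ∀ {V} → Digraph V → V → V → ℕ → Set
HasPath {V} D u v k = ∃[ ws ] IsPath {V} {k} D u v ws

Strong : ∀ {V} → Digraph V → Set
Strong D = ∀ u v → ∃[ k ] HasPath D u v k

steps : ∀ {V : Set} {k} → Vec V (suc k) → Vec (V × V) k
steps ws = zip (init ws) (tail ws)

EulerianCircuit : ∀ {V k} → Digraph V → Vec V (suc k) → Set
EulerianCircuit D ws =
  IsWalk D (head ws) (head ws) ws ×
  Unique (steps ws) ×
  (∀ {u v} → Arc D u v → (u , v) ∈ steps ws)

Eulerian : ∀ {V} → Digraph V → Set
Eulerian {V} D = Strong D × ∃[ k ] Σ[ ws ∈ Vec V (suc k) ] EulerianCircuit D ws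

_⊆_ : ∀ {V} → Digraph V → Digraph V → Set
S ⊆ D = ∀ {u v} → Arc S u v → Arc D u v

_∖_ : ∀ {V} → Digraph V → Digraph V → Digraph V
D ∖ S = record
  { Arc    = λ u v → Arc D u v × ¬ Arc S u v
  ; arc?   = λ u v → arc? D u v ×-dec ¬? (arc? S u v)
  ; irrefl = λ u≡v a → Digraph.irrefl D u≡v (proj₁ a)
  }

-- "Edge-connectivity at least l": the minimum of size S over the arc sets
-- S whose removal makes D not strong is at least l.
EdgeConnected : ∀ {n} → ℕ → Digraph (Fin n) → Set₁
EdgeConnected l D = ∀ S → S ⊆ D → ¬ Strong (D ∖ S) → l ≤ size S

least : ∀ {P : ℕ → Set} → U.Decidable P → ∀ n → P n →
        ∃[ k ] P k × (∀ {j} → P j → k ≤ j)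
least P? zero    p = 0 , p , λ _ → z≤n
least P? (suc n) p with P? 0
... | yes p₀ = 0 , p₀ , λ _ → z≤n
... | no ¬p₀ with least (λ k → P? (suc k)) n p
...   | k , pₖ , minimal = suc k , pₖ ,
        λ { {zero} p₀ → contradiction p₀ ¬p₀ ; {suc j} pⱼ → s≤s (minimal pⱼ) }

anyVec? : ∀ {n k} {P : Vec (Fin n) k → Set} → U.Decidable P → Dec (∃ P)
anyVec? {k = zero}  P? = map′ (λ p → [] , p) (λ { ([] , p) → p }) (P? [])
anyVec? {k = suc k} P? =
  map′ (λ (x , xs , p) → x ∷ xs , p) (λ { (x ∷ xs , p) → x , xs , p })
       (Fin.any? λ x → anyVec? λ xs → P? (x ∷ xs))

hasPath? : ∀ {n} (D : Digraph (Fin n)) u v → U.Decidable (HasPath D u v)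
hasPath? D u v k = anyVec? λ ws →
  (linked? (arc? D) ws ×-dec head ws Fin.≟ u ×-dec last ws Fin.≟ v)
  ×-dec allPairs? (λ x y → ¬? (x Fin.≟ y)) ws

dist : ∀ {n} (D : Digraph (Fin n)) → Strong D → Fin n → Fin n → ℕ
dist D strong u v = let k , path = strong u v in proj₁ (least (hasPath? D u v) k path)

instance
  pred-nonZero : ∀ {n} → .{{NonTrivial n}} → NonZero (pred n)
  pred-nonZero {suc (suc n)} = _

averageDistance : ∀ {n} .{{_ : NonTrivial n}} (D : Digraph (Fin n)) →
                  Strong D → Fin n → ℚ.ℚ
averageDistance {n} D strong v = + (∑ λ w → dist D strong v w) ℚ./ pred n

-- Average distances are nonnegative, so the default value 0 does not
-- affect the maximum.
remoteness : ∀ {n} .{{_ : NonTrivial n}} (D : Digraph (Fin n)) → Strong D → ℚ.ℚ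
remoteness {n} D strong =
  Extrema.max (DecTotalOrder.totalOrder ℚ.≤-decTotalOrder) ℚ.0ℚ (List.map (averageDistance D strong) (allFin n))

complete : ∀ n → Graph (Fin n)
complete n = record
  { Adj     = _≢_
  ; adj?    = λ u v → ¬? (u Fin.≟ v)
  ; irrefl  = λ u≡v u≢v → u≢v u≡v
  ; adj-sym = ≢-sym
  }

module _ {m} {V : Fin m → Set} (G : ∀ i → Graph (V i)) where

  data SumAdj : Rel (Σ (Fin m) V) 0ℓ where
    within   : ∀ {i x y} → Adj (G i) x y → SumAdj (i , x) (i , y)
    forward  : ∀ {i j x y} → toℕ j ≡ suc (toℕ i) → SumAdj (i , x) (j , y)
    backward : ∀ {i j x y} → toℕ i ≡ suc (toℕ j) → SumAdj (i , x) (j , y)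

  sumAdj? : Decidable SumAdj
  sumAdj? (i , x) (j , y) with toℕ j ℕ.≟ suc (toℕ i) | toℕ i ℕ.≟ suc (toℕ j) | i Fin.≟ j
  ... | yes f | _     | _        = yes (forward f)
  ... | no _  | yes b | _        = yes (backward b)
  ... | no ¬f | no ¬b | no i≢j   =
    no λ { (within _) → i≢j refl ; (forward f) → ¬f f ; (backward b) → ¬b b }
  ... | no ¬f | no ¬b | yes refl =
    map′ within (λ { (within a)   → a
                   ; (forward f)  → contradiction f ¬f
                   ; (backward b) → contradiction b ¬b })
         (adj? (G i) x y)

  sumAdj-irrefl : Irreflexive _≡_ SumAdj
  sumAdj-irrefl refl (within a)   = Graph.irrefl (G _) refl a
  sumAdj-irrefl refl (forward e)  = ℕ.1+n≢n (sym e)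
  sumAdj-irrefl refl (backward e) = ℕ.1+n≢n (sym e)

  sumAdj-sym : Symmetric SumAdj
  sumAdj-sym (within a)   = within (Graph.adj-sym (G _) a)
  sumAdj-sym (forward e)  = backward e
  sumAdj-sym (backward e) = forward e

  sequentialSum : Graph (Σ (Fin m) V)
  sequentialSum = record
    { Adj = SumAdj ; adj? = sumAdj? ; irrefl = sumAdj-irrefl ; adj-sym = sumAdj-sym }

-- The list a₁ ∷ … ∷ aₖ ∷ [] stands for K_a₁ + … + K_aₖ.
completeSum : (as : List ℕ) → Graph (Σ[ i ∈ Fin (length as) ] Fin (List.lookup as i))
completeSum as = sequentialSum λ i → complete (List.lookup as i)

infix 4 _≅_

_≅_ : ∀ {V W} → Graph V → Graph W → Set
_≅_ {V} {W} G H =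
  Σ[ f ∈ V ↔ W ] ∀ u v → Adj G u v ⇔ Adj H (Inverse.to f u) (Inverse.to f v)

[K₁+K_]^_ : ℕ → ℕ → List ℕ
[K₁+K l ]^ k = concat (replicate k (1 ∷ l ∷ []))

-- Intended for l ∈ {2, 3} only.
data PathComplete (l : ℕ) {n} (G : Graph (Fin n)) : Set where
  type-i   : ∀ k a b → 1 ≤ k → 1 ≤ a → 1 ≤ b → l ≤ a * b →
             G ≅ completeSum (([K₁+K l ]^ k) ++ a ∷ b ∷ []) →
             PathComplete l G
  type-ii  : ∀ k a b → 1 ≤ a → 1 ≤ b → l ≤ a →
             G ≅ completeSum (([K₁+K l ]^ k) ++ 1 ∷ a ∷ b ∷ []) →
             PathComplete l G
  type-iii : ∀ k a → l ≡ 3 → 1 ≤ k → 3 ≤ a →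
             G ≅ completeSum (([K₁+K 3 ]^ k) ++ 2 ∷ a ∷ 1 ∷ []) →
             PathComplete l G

IsMinimumPathComplete : ℕ → (n m₀ : ℕ) → Graph (Fin n) → Set₁
IsMinimumPathComplete l n m₀ G =
  PathComplete l G × m₀ ≤ graphSize G ×
  (∀ (H : Graph (Fin n)) → PathComplete l H → m₀ ≤ graphSize H → graphSize G ≤ graphSize H)

{-# OPTIONS --safe #-}
module Submission where

-- Let a₀, …, a_d be the sizes of the distance layers of a vertex v of D. As D is
-- Eulerian, the lengths of the jumps between layers sum to 0 over all arcs, so D has
-- at most as many backward arcs as forward arcs, and its size is at most twice that
-- of K_a₀ + … + K_a_d. Consecutive layers satisfy aᵢ aᵢ₊₁ ≥ λ by edge-connectivity.
-- It remains to see that among such sequences of given sum and distance sum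
-- σ = Σ i aᵢ the path-complete ones have the fewest nonadjacent pairs, and that for
-- these the number of nonadjacent pairs increases with σ.
--
-- The number of nonadjacent pairs is Σ aⱼ Tⱼ₊₂ with tail sums Tⱼ = aⱼ + aⱼ₊₁ + …,
-- and path-complete graphs fill T₂, T₃, … greedily at alternating costs 1 and λ. A
-- maximal prefix [K₁ + K_λ]^k is split off. If the rest starts with 1 and a layer
-- larger than λ, vertices are moved until that layer has size λ. If it starts with a
-- layer of size b ≥ 2, the pairs of weights aⱼ + aⱼ₊₁ ≥ λ + 1 put its cost above the
-- line of slope (λ + 1) / 2, and the greedy cost stays below that line.
--
-- The bidirected path-complete graph attains the bound: adjacent vertices have λ − 1
-- common neighbours, which makes it λ-edge-connected, and it is balanced and strong.

open import Defs
import Algebra.Properties.Semiring.Sum as SemiringSum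
open import Data.Empty using (⊥-elim)
open import Data.Fin.Base as Fin using (Fin; toℕ; _↑ˡ_; _↑ʳ_)
import Data.Fin.Properties as Fin
import Data.Integer.Base as ℤ
import Data.Integer.Properties as ℤ
open import Data.List.Base as List
  using (List; []; _∷_; _++_; allFin; cartesianProduct; drop; length; lookup)
import Data.List.Extrema as Extrema
import Data.List.Membership.DecPropositional as DecMembership
open import Data.List.Membership.Propositional using () renaming (_∈_ to _∈ᴸ_)
open import Data.List.Membership.Propositional.Properties using (∈-allFin; ∈-cartesianProduct⁺)
open import Data.List.Relation.Binary.Permutation.Propositional
  using (_↭_; ↭-prep; ↭-refl; ↭-swap; ↭-sym; ↭-trans; ↭⇒↭ₛ)
open import Data.List.Relation.Binary.Permutation.Propositional.Properties using (∈-resp-↭)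
import Data.List.Relation.Binary.Permutation.Setoid.Properties as Permutation
import Data.List.Relation.Unary.All as LAll
import Data.List.Relation.Unary.All.Properties as LAll
import Data.List.Relation.Unary.AllPairs as LAllPairs
import Data.List.Relation.Unary.Any as LAny
open import Data.List.Relation.Unary.Linked as Linked using (Linked; [-]) renaming (_∷_ to _◂_)
import Data.List.Relation.Unary.Unique.Propositional as LUnique
open import Data.Nat.Base
open import Data.Nat.ListAction using (sum)
open import Data.Nat.Properties
open import Data.Nat.Tactic.RingSolver using (solve; solve-∀)
open import Data.Product.Base using (∃; ∃-syntax; Σ-syntax; _×_; _,_; proj₁; proj₂)
open import Data.Product.Properties using (,-injectiveˡ; ≡-dec)
import Data.Rational.Base as ℚ
import Data.Rational.Properties as ℚ
import Data.Rational.Unnormalised.Base as ℚᵘ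
import Data.Rational.Unnormalised.Properties as ℚᵘ
open import Data.Sum.Base using (_⊎_; inj₁; inj₂; [_,_]′)
open import Data.Vec.Base as Vec using (Vec)
open import Data.Vec.Membership.Propositional using (_∈_)
import Data.Vec.Membership.Propositional.Properties as VMembership
import Data.Vec.Relation.Unary.All as All
import Data.Vec.Relation.Unary.All.Properties as VAll
import Data.Vec.Relation.Unary.AllPairs.Core as AllPairs
open import Data.Vec.Relation.Unary.Any using (here; there)
import Data.Vec.Relation.Unary.Linked as VLinked
open import Data.Vec.Relation.Unary.Unique.Propositional using (Unique)
open import Function.Base using (_∘_; id; const)
open import Function.Bundles using (_↔_; Equivalence; Inverse; mk↔ₛ′; mk⇔)
open import Function.Properties.Inverse using (↔-sym; ↔-trans)
open import Relation.Binary.Bundles using (DecTotalOrder)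
open import Relation.Binary.Definitions using (tri<; tri≈; tri>)
open import Relation.Binary.PropositionalEquality
  using (_≡_; _≢_; refl; sym; trans; cong; cong₂; subst; subst₂; setoid; module ≡-Reasoning)
open import Relation.Nullary.Decidable using (Dec; yes; no; _×-dec_; dec-true; dec-false)
open import Relation.Nullary.Negation using (¬_; contradiction)

private module Sum = SemiringSum +-*-semiring

-- Certificates for linear arithmetic: A ≤ B is a combination of the hypotheses
-- and W the remaining slack, so that Y − X = (B − A) + W.
lin : ∀ {A B X Y} W → A ≤ B → Y + A ≡ X + B + W → X ≤ Y
lin {A} {B} {X} {Y} W A≤B eq = +-cancelʳ-≤ B X Y
  (≤-trans (m≤m+n (X + B) W) (subst (_≤ Y + B) eq (+-monoʳ-≤ Y A≤B)))

infixr 6 _⊹_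
infixr 7 _⊛_

_⊹_ : ∀ {a b c d} → a ≤ b → c ≤ d → a + c ≤ b + d
_⊹_ = +-mono-≤

_⊛_ : ∀ k {a b} → a ≤ b → k * a ≤ k * b
k ⊛ a≤b = *-monoʳ-≤ k a≤b

split : ∀ {m n} → m ≤ n → ∃[ k ] n ≡ m + k
split {m} {n} m≤n = n ∸ m , sym (m+[n∸m]≡n m≤n)

-- Sequences of layer sizes

-- For K_a₀ + K_a₁ + …, σ is the sum of the distances from a vertex of the first
-- layer if a₀ = 1, and far is the number of pairs of nonadjacent vertices.
σ : List ℕ → ℕ
σ []       = 0
σ (x ∷ xs) = sum xs + σ xs

far : List ℕ → ℕ
far []       = 0
far (x ∷ xs) = x * sum (drop 1 xs) + far xs

-- Throughout, l = p + 1.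
module Sequences (p : ℕ) (1≤p : 1 ≤ p) (p≤2 : p ≤ 2) where


  Adm : List ℕ → Set
  Adm = Linked λ a b → suc p ≤ a * b

  -- Up to a term depending only on sum xs, this is far (1 ∷ l ∷ xs). In contrast to
  -- far it compares suffixes with different heads.
  weight : List ℕ → ℕ
  weight xs = suc p * sum (drop 1 xs) + far xs

  -- Factors of at least 2 already sum to 4, and `p ≤ 2`. With the converse `+⇒*` this turns the
  -- product condition on positive layer sizes into a sum condition, which is the form suited to
  -- counting and moving vertices.
  *⇒+ : ∀ a b → suc p ≤ a * b → (2 + p) ≤ a + b
  *⇒+ 1 b h = lin 0 h (solve (p ∷ b ∷ []))
  *⇒+ (suc (suc a)) 0 h = ⊥-elim (n≮0 (≤-trans h (≤-reflexive (*-zeroʳ a))))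
  *⇒+ (suc (suc a)) 1 h = lin 0 h (solve (p ∷ a ∷ []))
  *⇒+ (suc (suc a)) (suc (suc b)) h = lin (a + b) p≤2 (solve (p ∷ a ∷ b ∷ []))

  +⇒* : ∀ a b → (2 + p) ≤ suc a + suc b → suc p ≤ suc a * suc b
  +⇒* a b h = lin (a * b) h (solve (p ∷ a ∷ b ∷ []))

  posˡ : ∀ a b → suc p ≤ a * b → 1 ≤ a
  posˡ (suc a) b h = s≤s z≤n

  posʳ : ∀ a b → suc p ≤ a * b → 1 ≤ b
  posʳ a b h = posˡ b a (subst (suc p ≤_) (*-comm a b) h)

  -- `σ xs` is a sum of tail sums, and `far` charges each of them at the size of the layer two
  -- places before it. A layer of size at least 2 pays `2 * 2 ≥ 2 + p` per unit by itself. A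
  -- following layer of size 1 with a nonempty tail lies between layers of size at least `suc p`, so
  -- it is grouped with its predecessor, whose tail sum is larger; the next head is then again at
  -- least 2. A positive `σ xs` lets the excess `b` of the head earn the surplus `p * b`.
  average′ : ∀ b xs → Adm (2 + b ∷ xs) → (2 + p) * σ xs ≤ 2 * far (2 + b ∷ xs)
  average : ∀ b xs → 1 ≤ σ xs → Adm (2 + b ∷ xs) →
            (2 + p) * σ xs + p * b ≤ 2 * far (2 + b ∷ xs)

  average′ b xs adm with σ xs in eq
  ... | zero  = lin (2 * far (2 + b ∷ xs)) (z≤n {0}) (arith (far (2 + b ∷ xs)))
    where
    arith : ∀ f → 2 * f + 0 ≡ (2 + p) * 0 + 0 + 2 * f
    arith f = solve (p ∷ f ∷ [])
  ... | suc s = ≤-trans (m≤m+n _ (p * b))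
    (subst (λ u → (2 + p) * u + p * b ≤ 2 * far (2 + b ∷ xs)) eq (average b xs (subst (1 ≤_) (sym eq) (s≤s z≤n)) adm))

  average b (0 ∷ _) _ (h ◂ _) = ⊥-elim (1+n≰n (≤-trans (posʳ (2 + b) 0 h) z≤n))
  average b (1 ∷ 0 ∷ _) _ (_ ◂ h ◂ _) = ⊥-elim (1+n≰n (≤-trans (posʳ 1 0 h) z≤n))
  average b (1 ∷ 1 ∷ _) _ (_ ◂ h ◂ _) = ⊥-elim (1+n≰n (≤-trans 1≤p (≤-pred h)))
  average b (1 ∷ suc (suc d) ∷ rest) _ (h ◂ h′ ◂ adm) =
    arith (sum rest) (σ rest) (far (2 + d ∷ rest)) (average′ d rest adm)
    where
    arith : ∀ s t f → (2 + p) * t ≤ 2 * f →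
            (2 + p) * (2 + d + s + (s + t)) + p * b ≤ 2 * ((2 + b) * (2 + d + s) + (1 * s + f))
    arith s t f ih =
      lin (1 + p + b) (ih ⊹ (2 * s + (2 + d)) ⊛ h ⊹ (1 + b) ⊛ h′)
          (solve (p ∷ b ∷ d ∷ s ∷ t ∷ f ∷ []))
  average b xs@(c@(suc (suc c′)) ∷ d ∷ rest) _ (h ◂ h′ ◂ adm) =
    arith (d + sum rest) (σ (d ∷ rest)) (far xs)
      (≤-trans (posʳ c d h′) (m≤m+n d _)) (average′ c′ (d ∷ rest) (h′ ◂ adm))
    where
    arith : ∀ T S F → 1 ≤ T → (2 + p) * S ≤ 2 * F →
            (2 + p) * (T + S) + p * b ≤ 2 * ((2 + b) * T + F)
    arith T S F 1≤T ih =
      lin 0 (ih ⊹ T ⊛ p≤2 ⊹ b ⊛ p≤2 ⊹ (2 * b) ⊛ 1≤T) (solve (p ∷ b ∷ T ∷ S ∷ F ∷ []))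

  -- Every layer is nonempty, so each unit of a tail sum costs at least one nonadjacent pair.
  σ≤far : ∀ b rest → 1 ≤ b → Adm (b ∷ rest) → σ rest ≤ far (b ∷ rest)
  σ≤far b [] _ _ = z≤n
  σ≤far b (c ∷ rest) 1≤b (h ◂ adm) =
    ≤-trans (m≤m*n (sum rest) b {{>-nonZero 1≤b}}) (≤-reflexive (*-comm (sum rest) b))
    ⊹ σ≤far c rest (posʳ b c h) adm

  -- The types (i), (ii), (iii) of path-complete graphs, where k = 0 is always
  -- allowed: the recursion on prefixes [K₁ + K_l] needs suffixes to be canonical.
  data Canon : List ℕ → Set where
    two   : ∀ a b → suc p ≤ a * b → Canon (a ∷ b ∷ [])
    three : ∀ a b → suc p ≤ a → 1 ≤ b → Canon (1 ∷ a ∷ b ∷ [])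
    extra : ∀ a → p ≡ 2 → 3 ≤ a → Canon (2 ∷ a ∷ 1 ∷ [])
    step  : ∀ {cs} → Canon cs → Canon (1 ∷ suc p ∷ cs)

  -- For a first layer of size 1, `m` vertices remain, `t` is the part of `σ` beyond the first tail
  -- sum, and the last inequality reads `2 * far cs + p ≤ (2 + p) * t`. The saving `p` comes from
  -- filling at cost 1 first.
  Filled : ℕ → ℕ → List ℕ → Set
  Filled m t cs = Canon cs × sum cs ≡ suc m × σ cs ≡ m + t ×
                  2 * weight cs + p ≤ 2 * suc p * m + (2 + p) * t

  -- The canonical sequences of order m + 1 fill the tail sums greedily; their
  -- weights stay below the line of average slope (p + 2) / 2.
  fill : ∀ xs m t → Adm xs → sum xs ≤ suc m → 1 ≤ t → t ≤ σ (drop 1 xs) →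
         ∃ (Filled m t)
  fill [] m t _ _ 1≤t t≤ = ⊥-elim (1+n≰n (≤-trans 1≤t t≤))
  fill (x ∷ []) m t _ _ 1≤t t≤ = ⊥-elim (1+n≰n (≤-trans 1≤t t≤))
  fill (x ∷ y ∷ []) m t _ _ 1≤t t≤ = ⊥-elim (1+n≰n (≤-trans 1≤t t≤))
  fill (x ∷ y ∷ z ∷ rest) m t (h ◂ h′ ◂ adm) sum≤ 1≤t t≤ = go
    where
    s = sum rest

    -- `xs` only witnesses that `t` is reachable. Its first two layers have at least `2 + p`
    -- vertices, which leaves a capacity `w` for the tail sum from the third layer on.
    order : ∃[ w ] m ≡ 1 + p + w × z + s ≤ w
    order with split {1 + p} {m} (lin (z + s) (sum≤ ⊹ *⇒+ x y h) (arith s m))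
      where
      arith : ∀ s m → m + (x + (y + (z + s)) + suc (suc p)) ≡ 1 + p + (suc m + (x + y)) + (z + s)
      arith s m = solve (x ∷ y ∷ z ∷ s ∷ m ∷ p ∷ [])
    ... | w , refl = w , refl , lin 0 (sum≤ ⊹ *⇒+ x y h) (arith s w)
      where
      arith : ∀ s w → w + (x + (y + (z + s)) + suc (suc p)) ≡ z + s + (suc (1 + p + w) + (x + y)) + 0
      arith s w = solve (x ∷ y ∷ z ∷ s ∷ w ∷ p ∷ [])

    -- Here the tail sum from the third layer on is filled up to `w`, and `r` is left for the later
    -- tail sums.
    beyond : ∀ w r → z + s ≤ w → 1 ≤ r → m ≡ 1 + p + w → t ≡ w + r → ∃ (Filled m t)
    beyond w r zs≤w 1≤r refl refl with suc r ≤? w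
    ... | yes r<w with split r<w
    ...   | e , refl =
      _ , step (two (suc e) (suc (pred r)) (+⇒* e (pred r) (≤-trans μ≤w (≤-reflexive w≡))))
        , trans (cong (λ r → 1 + (suc p + (suc e + (r + 0)))) r≡) (solve (p ∷ e ∷ r ∷ []))
        , trans (cong (λ r → suc p + (suc e + (r + 0)) + (suc e + (r + 0) + (r + 0 + 0))) r≡) (solve (p ∷ e ∷ r ∷ []))
        , subst (λ q → 2 * (suc p * (suc p + (suc e + (q + 0))) + (1 * (suc e + (q + 0)) + (suc p * (q + 0) + (suc e * 0 + (q * 0 + 0))))) + p
                       ≤ 2 * suc p * (1 + p + (suc r + e)) + (2 + p) * (suc r + e + r)) (sym r≡)
            (lin (p * e) z≤n (solve (p ∷ e ∷ r ∷ [])))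
      where
      r≡ : suc (pred r) ≡ r
      r≡ = suc-pred r {{>-nonZero 1≤r}}
      w≡ : suc r + e ≡ suc e + suc (pred r)
      w≡ = trans (cong suc (+-comm r e)) (cong (suc e +_) (sym r≡))
      r≤ : r ≤ s + σ rest
      r≤ = lin 0 (t≤ ⊹ zs≤w) (arith s r (σ rest) e)
        where
        arith : ∀ s r u e → s + u + (suc r + e + r + (z + s)) ≡ r + (z + s + (s + u) + (suc r + e)) + 0
        arith s r u e = solve (z ∷ s ∷ r ∷ u ∷ e ∷ [])
      -- As `r` is positive, the witness has a layer after `z`. Two admissible layers thus fit into
      -- `w`, so the last pair `suc e`, `r` of sum `w` is admissible too.
      μ≤w : (2 + p) ≤ suc r + e
      μ≤w = ≤-trans (μ≤ rest adm (≤-trans 1≤r r≤)) zs≤w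
        where
        μ≤ : ∀ rest → Adm (z ∷ rest) → 1 ≤ sum rest + σ rest → (2 + p) ≤ z + sum rest
        μ≤ [] _ ()
        μ≤ (y′ ∷ r′) (g ◂ _) _ = ≤-trans (*⇒+ z y′ g) (≤-trans (m≤m+n _ (sum r′)) (≤-reflexive (+-assoc z y′ _)))
    beyond 0 r zs≤w 1≤r refl refl | no r≮w =
      ⊥-elim (1+n≰n (≤-trans (posʳ y z h′) (≤-trans (m≤m+n z s) zs≤w)))
    beyond (suc m′) r zs≤w 1≤r refl refl | no r≮w with split (≤-pred (≰⇒> r≮w))
    -- Here `w = suc m′` and `r = suc m′ + r′`. The recursive sequence has order `w`, so `m′` of `r`
    -- goes to its first tail sum and `suc r′` remains.
    ... | r′ , refl with fill (z ∷ rest) m′ (suc r′) adm zs≤w (s≤s z≤n) r′≤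
      where
      r′≤ : suc r′ ≤ σ rest
      r′≤ = lin 0 (t≤ ⊹ zs≤w ⊹ zs≤w ⊹ posʳ y z h′ ) (arith s (σ rest))
        where
        arith : ∀ s u → u + (suc m′ + (suc m′ + r′) + (z + s + (z + s + 1))) ≡
                        suc r′ + (z + s + (s + u) + (suc m′ + (suc m′ + z))) + 0
        arith s u = solve (s ∷ u ∷ m′ ∷ r′ ∷ z ∷ [])
    ...   | cs , canon , sum≡ , σ≡ , w≤ =
      _ , step canon , arith₁ (sum cs) sum≡ , arith₂ (sum cs) (σ cs) sum≡ σ≡ ,
      arith₃ (sum cs) (sum (drop 1 cs)) (far cs) sum≡ w≤
      where
      arith₁ : ∀ S → S ≡ suc m′ → 1 + (suc p + S) ≡ suc (1 + p + suc m′)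
      arith₁ S refl = refl
      arith₂ : ∀ S u → S ≡ suc m′ → u ≡ m′ + suc r′ → suc p + S + (S + u) ≡ 1 + p + suc m′ + (suc m′ + (suc m′ + r′))
      arith₂ S u refl refl = solve (p ∷ m′ ∷ r′ ∷ [])
      arith₃ : ∀ S D F → S ≡ suc m′ → 2 * (suc p * D + F) + p ≤ 2 * suc p * m′ + (2 + p) * suc r′ →
               2 * (suc p * (suc p + S) + (1 * S + (suc p * D + F))) + p
               ≤ 2 * suc p * (1 + p + suc m′) + (2 + p) * (suc m′ + (suc m′ + r′))
      arith₃ S D F refl ih = lin p ih (solve (p ∷ m′ ∷ r′ ∷ D ∷ F ∷ []))

    go : ∃ (Filled m t)
    go with order
    ... | w , refl , zs≤w with t ≤? w
    ...   | no t≰w = let r , t≡ = split (≰⇒> t≰w) in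
                     beyond w (suc r) zs≤w (s≤s z≤n) refl (trans t≡ (sym (+-suc w r)))
    -- One tail sum of size `t`, charged at the first layer of size 1, is enough; the spare capacity
    -- `e` goes to the second layer.
    ...   | yes t≤w with split t≤w
    ...     | e , refl = _ , three (1 + p + e) t (m≤m+n _ _) 1≤t , sum≡ , σ≡ , weight≤
      where
      sum≡ : 1 + (1 + p + e + (t + 0)) ≡ suc (1 + p + (t + e))
      sum≡ = solve (p ∷ e ∷ t ∷ [])
      σ≡ : 1 + p + e + (t + 0) + (t + 0 + 0) ≡ 1 + p + (t + e) + t
      σ≡ = solve (p ∷ e ∷ t ∷ [])
      weight≤ : 2 * (suc p * (1 + p + e + (t + 0)) + (1 * (t + 0) + ((1 + p + e) * 0 + (t * 0 + 0)))) + p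
                ≤ 2 * suc p * (1 + p + (t + e)) + (2 + p) * t
      weight≤ = lin 0 (p ⊛ 1≤t) (solve (p ∷ e ∷ t ∷ []))

  Better : List ℕ → Set
  Better xs = ∃[ cs ] Canon cs × sum cs ≡ sum xs × σ cs ≡ σ xs × weight cs ≤ weight xs

  canon⇒better : ∀ {xs} → Canon xs → Better xs
  canon⇒better {xs} c = xs , c , refl , refl , ≤-refl

  -- Sequences whose first layer has at least two vertices

  module WideHead (b c d : ℕ) (rest : List ℕ) (adm : Adm (2 + b ∷ c ∷ d ∷ rest)) where

    xs ys zs : List ℕ
    xs = 2 + b ∷ ys
    ys = c ∷ zs
    zs = d ∷ rest

    1≤c : 1 ≤ c
    1≤c = posʳ (2 + b) c (Linked.head adm)

    -- All later layers together with `σ ys` vertices of the first one become a single second layer.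
    -- This keeps `σ` and leaves no nonadjacent pairs, so the weights compare exactly by the last
    -- hypothesis.
    short : ∀ e → suc b ≡ σ ys + e → suc p * σ ys ≤ far xs → Better xs
    short e b≡ h = (suc e ∷ q ∷ []) , two (suc e) q (positive q 1≤q (≤-trans μ≤ (≤-reflexive (sym total))))
      , trans (cong (suc e +_) (+-identityʳ q)) total
      , trans (+-identityʳ (q + 0)) (+-identityʳ q)
      , arith (sum ys) (σ ys) (far xs) h
      where
      q = sum ys + σ ys
      1≤q : 1 ≤ q
      1≤q = ≤-trans 1≤c (≤-trans (m≤m+n c (sum zs)) (m≤m+n (sum ys) (σ ys)))
      total : suc e + q ≡ 2 + b + sum ys
      total = trans (arith′ (sum ys) (σ ys)) (cong (λ β → suc β + sum ys) (sym b≡))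
        where
        arith′ : ∀ T s → suc e + (T + s) ≡ suc (s + e) + T
        arith′ T s = solve (e ∷ T ∷ s ∷ [])
      positive : ∀ q → 1 ≤ q → 2 + p ≤ suc e + q → suc p ≤ suc e * q
      positive (suc q) _ = +⇒* e q
      μ≤ : 2 + p ≤ 2 + b + sum ys
      μ≤ = ≤-trans (*⇒+ (2 + b) c (Linked.head adm)) (+-monoʳ-≤ (2 + b) (m≤m+n c (sum zs)))
      arith : ∀ T s F → suc p * s ≤ F →
              suc p * (T + s + 0) + (suc e * 0 + ((T + s) * 0 + 0)) ≤ suc p * T + F
      arith T s F h = lin 0 h (solve (p ∷ e ∷ T ∷ s ∷ F ∷ []))

    -- `fill` is applied with `xs` as its own witness. The surplus `p * b` of `average` and the
    -- saving `p` of `fill` make the two bounds meet with no slack.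
    long : ∀ t → σ ys ≡ 2 + b + t → Better xs
    long t s≡ with fill xs (1 + b + sum ys) (suc t) adm ≤-refl (s≤s z≤n)
                     (≤-trans (m≤n+m (suc t) (suc b)) (≤-reflexive (sym (trans s≡ (cong suc (sym (+-suc b t)))))))
    ... | cs , canon , sum≡ , σ≡ , w≤ = cs , canon , sum≡ ,
      trans σ≡ (trans (arith₁ (sum ys)) (cong (sum ys +_) (sym s≡))) ,
      arith₂ (sum ys) (weight cs) (far xs) w≤
        (subst (λ u → (2 + p) * u + p * b ≤ 2 * far xs) s≡
          (average b ys (≤-trans (s≤s z≤n) (≤-reflexive (sym s≡))) adm))
      where
      arith₁ : ∀ T → 1 + b + T + suc t ≡ T + (2 + b + t)
      arith₁ T = solve (b ∷ t ∷ T ∷ [])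
      arith₂ : ∀ T W F → 2 * W + p ≤ 2 * suc p * (1 + b + T) + (2 + p) * suc t →
               (2 + p) * (2 + b + t) + p * b ≤ 2 * F → W ≤ suc p * T + F
      arith₂ T W F h₁ h₂ = *-cancelˡ-≤ 2 (doubled)
        where
        doubled : 2 * W ≤ 2 * (suc p * T + F)
        doubled = lin 0 (h₁ ⊹ h₂) (solve (p ∷ b ∷ t ∷ T ∷ W ∷ F ∷ []))

    -- With `T = sum zs` and `S = σ zs`, the first layer has at least `1 + T + S` vertices. Its term
    -- is at least `T + (T + S) * p`, and `σ≤far` contributes the missing `S`.
    far≥ : ∀ e → suc b ≡ σ ys + e → p ≤ sum zs → suc p * σ ys ≤ far xs
    far≥ e b≡ p≤T = arith (sum zs) (σ zs) (far ys) (suc b) b≡ p≤T (σ≤far c zs 1≤c (Linked.tail adm))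
      where
      arith : ∀ T S F β → β ≡ T + S + e → p ≤ T → S ≤ F → suc p * (T + S) ≤ suc β * T + F
      arith T S F _ refl p≤T S≤F = lin (e * T) ((T + S) ⊛ p≤T ⊹ S≤F) (solve (p ∷ e ∷ T ∷ S ∷ F ∷ []))

  -- If neither `long` nor `short` with `far≥` applies, fewer than `p` vertices lie beyond the
  -- second layer. This forces `p = 2` and the sequence `2 + b`, `c`, `1`. For `b = 0` it is the
  -- canonical type `extra`; for larger `b` the first layer is big enough to use `short` directly.
  wide : ∀ b c d rest → Adm (2 + b ∷ c ∷ d ∷ rest) → Better (2 + b ∷ c ∷ d ∷ rest)
  wide b c d rest adm with 2 + b ≤? σ (c ∷ d ∷ rest)
  ... | yes h = let t , s≡ = split h in WideHead.long b c d rest adm t s≡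
  ... | no ¬h with p ≤? d + sum rest | split (≤-pred (≰⇒> ¬h))
  ...   | yes p≤T | e , b≡ = WideHead.short b c d rest adm e b≡ (WideHead.far≥ b c d rest adm e b≡ p≤T)
  ...   | no p≰T | _ = tiny b d rest adm (≰⇒> p≰T)
    where
    tiny : ∀ b d rest → Adm (2 + b ∷ c ∷ d ∷ rest) → d + sum rest < p → Better (2 + b ∷ c ∷ d ∷ rest)
    tiny b 0 rest (_ ◂ h ◂ _) _ = ⊥-elim (1+n≰n (≤-trans (posʳ c 0 h) z≤n))
    tiny b (suc (suc d)) rest _ h = ⊥-elim (1+n≰n (≤-trans (s≤s (s≤s (s≤s z≤n))) (≤-trans h p≤2)))
    tiny b 1 (0 ∷ rest) (_ ◂ _ ◂ h ◂ _) _ = ⊥-elim (1+n≰n (≤-trans (posʳ 1 0 h) z≤n))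
    tiny b 1 (suc y ∷ rest) _ h = ⊥-elim (1+n≰n (≤-trans (s≤s (s≤s (s≤s z≤n))) (≤-trans h p≤2)))
    tiny zero 1 [] (_ ◂ h ◂ _) 1<p =
      canon⇒better (extra c p≡2 (≤-trans (≤-reflexive (cong suc (sym p≡2))) (≤-trans h (≤-reflexive (*-identityʳ c)))))
      where
      p≡2 = ≤-antisym p≤2 1<p
    tiny (suc b) 1 [] adm _ = WideHead.short (suc b) c 1 [] adm (suc b) refl
      arith
      where
      arith : suc p * 1 ≤ (3 + b) * 1 + (c * 0 + 0)
      arith = lin b p≤2 (solve (p ∷ b ∷ c ∷ []))

  -- Reduction to canonical sequences

  merge : ℕ → ℕ → List ℕ
  merge b (suc (suc y)) = suc b ∷ suc y ∷ []
  merge b y             = b + y ∷ []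

  -- One vertex of the last layer moves to the layer before it; a last layer of size 1 disappears.
  -- On admissible sequences this lowers `σ` by exactly 1.
  pull : ℕ → ℕ → List ℕ → List ℕ
  pull b y []       = merge b y
  pull b y (z ∷ zs) = b ∷ pull y z zs

  sum-pull : ∀ b y ys → sum (pull b y ys) ≡ b + (y + sum ys)
  sum-pull b 0             []       = +-assoc b 0 0
  sum-pull b 1             []       = +-assoc b 1 0
  sum-pull b (suc (suc y)) []       = sym (+-suc b (suc (y + 0)))
  sum-pull b y             (z ∷ zs) = cong (b +_) (sum-pull y z zs)

  σ-pull : ∀ b y ys → Adm (b ∷ y ∷ ys) → suc (σ (pull b y ys)) ≡ σ (b ∷ y ∷ ys)
  σ-pull b 0             []       (h ◂ _) = ⊥-elim (1+n≰n (≤-trans (posʳ b 0 h) z≤n))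
  σ-pull b 1             []       _       = refl
  σ-pull b (suc (suc y)) []       _       = refl
  σ-pull b y             (z ∷ zs) (_ ◂ adm) =
    trans (sym (+-suc _ _)) (cong₂ _+_ (sum-pull y z zs) (σ-pull y z zs adm))

  tail-pull : ∀ b y ys → sum (drop 1 (pull b y ys)) ≤ y + sum ys
  tail-pull b 0             []       = z≤n
  tail-pull b 1             []       = z≤n
  tail-pull b (suc (suc y)) []       = n≤1+n _
  tail-pull b y             (z ∷ zs) = ≤-reflexive (sum-pull y z zs)

  far-pull : ∀ b y ys → far (pull b y ys) ≤ far (b ∷ y ∷ ys)
  far-pull b 0             []       = ≤-reflexive (cong (_+ 0) (trans (*-zeroʳ (b + 0)) (sym (*-zeroʳ b))))
  far-pull b 1             []       = ≤-trans (≤-reflexive (cong (_+ 0) (*-zeroʳ (b + 1)))) z≤n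
  far-pull b (suc (suc y)) []       = ≤-reflexive (trans (arith b y) (sym (arith′ b y)))
    where
    arith : ∀ b y → suc b * 0 + (suc y * 0 + 0) ≡ 0
    arith = solve-∀
    arith′ : ∀ b y → b * 0 + (suc (suc y) * 0 + 0) ≡ 0
    arith′ = solve-∀
  far-pull b y             (z ∷ zs) = b ⊛ tail-pull y z zs ⊹ far-pull y z zs

  -- The last two layers keep their sum, so the sum form of admissibility survives as long as both
  -- are nonempty.
  adm-pull : ∀ x b y ys → Adm (x ∷ b ∷ y ∷ ys) → Adm (x ∷ pull b y ys)
  adm-pull x b 0       []       (h ◂ _) = ≤-trans h (x ⊛ m≤m+n b 0) ◂ [-]
  adm-pull x b 1       []       (h ◂ _) = ≤-trans h (x ⊛ m≤m+n b 1) ◂ [-]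
  adm-pull x b (suc (suc y)) [] (h ◂ h′ ◂ _) =
    ≤-trans h (x ⊛ n≤1+n b) ◂
    +⇒* b y (≤-trans (*⇒+ b (2 + y) h′) (≤-reflexive (+-suc b (suc y)))) ◂ [-]
  adm-pull x b y       (z ∷ zs) (h ◂ adm) = h ◂ adm-pull b y z zs adm

  adm-suc : ∀ b xs → Adm (b ∷ xs) → Adm (suc b ∷ xs)
  adm-suc b []       _         = [-]
  adm-suc b (x ∷ xs) (h ◂ adm) = ≤-trans h (m≤n+m _ x) ◂ adm

  -- A vertex of a too large second layer moves to the third layer; in exchange pull
  -- moves a vertex of the last layer to the layer before, which restores σ. The
  -- weight does not grow, since the first layer is a single vertex.
  balance : ∀ c b y ys → suc p ≤ c → Adm (1 ∷ suc c ∷ b ∷ y ∷ ys) →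
            ∃[ b′ ] ∃[ zs ] Adm (1 ∷ c ∷ b′ ∷ zs) × b′ + sum zs ≡ suc (b + (y + sum ys)) ×
            σ (1 ∷ c ∷ b′ ∷ zs) ≡ σ (1 ∷ suc c ∷ b ∷ y ∷ ys) ×
            weight (1 ∷ c ∷ b′ ∷ zs) ≤ weight (1 ∷ suc c ∷ b ∷ y ∷ ys)
  balance c b 0 [] _ (_ ◂ _ ◂ h ◂ _) = ⊥-elim (1+n≰n (≤-trans (posʳ b 0 h) z≤n))
  balance c b 1 [] l≤c (_ ◂ h ◂ h′ ◂ _) = 2 + b , [] ,
    ≤-trans l≤c (m≤m+n c 0) ◂ ≤-trans l≤c (m≤m*n c (2 + b)) ◂ [-] ,
    arith₁ b , arith₂ b c , arith₃ b c
    where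
    arith₁ : ∀ b → 2 + b + 0 ≡ suc (b + 1)
    arith₁ = solve-∀
    arith₂ : ∀ b c → c + (2 + b + 0) + (2 + b + 0 + 0) ≡ suc c + (b + 1) + (b + 1 + 1)
    arith₂ = solve-∀
    arith₃ : ∀ b c → suc p * (c + (2 + b + 0)) + (1 * (2 + b + 0) + (c * 0 + ((2 + b) * 0 + 0))) ≤
                     suc p * (suc c + (b + 1)) + (1 * (b + 1) + (suc c * 1 + (b * 0 + (1 * 0 + 0))))
    arith₃ b c = lin c (z≤n {0}) (solve (p ∷ b ∷ c ∷ []))
  balance c b (suc (suc y)) [] l≤c (_ ◂ h ◂ h′ ◂ _) = 2 + b , suc y ∷ [] ,
    ≤-trans l≤c (m≤m+n c 0) ◂ ≤-trans l≤c (m≤m*n c (2 + b)) ◂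
      +⇒* (suc b) y (≤-trans (*⇒+ b (2 + y) h′) (≤-trans (n≤1+n _) (≤-reflexive (arith₀ b y)))) ◂ [-] ,
    arith₁ b y , arith₂ b c y , arith₃ b c y
    where
    arith₀ : ∀ b y → suc (b + (2 + y)) ≡ 2 + b + suc y
    arith₀ = solve-∀
    arith₁ : ∀ b y → 2 + b + (suc y + 0) ≡ suc (b + (2 + y + 0))
    arith₁ = solve-∀
    arith₂ : ∀ b c y → c + (2 + b + (suc y + 0)) + (2 + b + (suc y + 0) + (suc y + 0 + 0)) ≡
                       suc c + (b + (2 + y + 0)) + (b + (2 + y + 0) + (2 + y + 0 + 0))
    arith₂ = solve-∀
    arith₃ : ∀ b c y → suc p * (c + (2 + b + (suc y + 0))) +
                       (1 * (2 + b + (suc y + 0)) + (c * (suc y + 0) + ((2 + b) * 0 + (suc y * 0 + 0)))) ≤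
                       suc p * (suc c + (b + (2 + y + 0))) +
                       (1 * (b + (2 + y + 0)) + (suc c * (2 + y + 0) + (b * 0 + ((2 + y) * 0 + 0))))
    arith₃ b c y = lin (c + 1 + y) (z≤n {0}) (solve (p ∷ b ∷ c ∷ y ∷ []))
  balance c b y (z ∷ zs) l≤c (_ ◂ h ◂ adm) = suc b , pull y z zs ,
    ≤-trans l≤c (m≤m+n c 0) ◂ ≤-trans l≤c (m≤m*n c (suc b)) ◂ adm-suc b _ (adm-pull b y z zs adm) ,
    cong (suc b +_) (sum-pull y z zs) ,
    arith₂ (sum (pull y z zs)) (σ (pull y z zs)) (y + (z + sum zs)) (σ (y ∷ z ∷ zs))
      (sum-pull y z zs) (σ-pull y z zs (Linked.tail adm)) ,
    arith₃ (sum (pull y z zs)) (sum (drop 1 (pull y z zs))) (z + sum zs) (far (pull y z zs)) (far (y ∷ z ∷ zs))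
      (sum-pull y z zs) (posʳ b y (Linked.head adm)) (tail-pull y z zs) (far-pull y z zs)
    where
    arith₂ : ∀ S u T v → S ≡ T → suc u ≡ v → c + (suc b + S) + (suc b + S + (S + u)) ≡ suc c + (b + T) + (b + T + (T + v))
    arith₂ S u _ _ refl refl = solve (b ∷ c ∷ S ∷ u ∷ [])
    arith₃ : ∀ S D T F G → S ≡ y + T → 1 ≤ y → D ≤ T → F ≤ G →
             suc p * (c + (suc b + S)) + (1 * (suc b + S) + (c * S + (suc b * D + F))) ≤
             suc p * (suc c + (b + (y + T))) + (1 * (b + (y + T)) + (suc c * (y + T) + (b * T + G)))
    arith₃ _ D T F G refl 1≤y D≤T F≤G =
      lin 0 (1≤y ⊹ suc b ⊛ D≤T ⊹ F≤G) (solve (p ∷ b ∷ c ∷ y ∷ D ∷ T ∷ F ∷ G ∷ []))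

  better-trans : ∀ xs ys → sum xs ≡ sum ys → σ xs ≡ σ ys → weight xs ≤ weight ys → Better xs → Better ys
  better-trans _ _ s≡ σ≡ w≤ (cs , canon , s≡′ , σ≡′ , w≤′) =
    cs , canon , trans s≡′ s≡ , trans σ≡′ σ≡ , ≤-trans w≤′ w≤

  better-step : ∀ xs → Better xs → Better (1 ∷ suc p ∷ xs)
  better-step xs (cs , canon , s≡ , σ≡ , w≤) = 1 ∷ suc p ∷ cs , step canon ,
    cong (λ s → 1 + (suc p + s)) s≡ , cong₂ _+_ (cong (suc p +_) s≡) (cong₂ _+_ s≡ σ≡) ,
    (≤-reflexive (cong (λ s → suc p * (suc p + s)) s≡)) ⊹ (≤-reflexive (cong (1 *_) s≡)) ⊹ w≤

  -- With the call on shorter sequences as a parameter, `strip` recurses on the excess `k` of the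
  -- second layer alone, while `canonicalise` recurses on the bound `f` for the order.
  module Recursion (f : ℕ) (rec : ∀ x y ys → Adm (x ∷ y ∷ ys) → sum (x ∷ y ∷ ys) ≤ f → Better (x ∷ y ∷ ys)) where

    strip : ∀ k b ys → Adm (1 ∷ k + suc p ∷ b ∷ ys) → k + suc p + (b + sum ys) ≤ f → Better (1 ∷ k + suc p ∷ b ∷ ys)
    strip k b [] (h ◂ h′ ◂ _) _ = canon⇒better (three (k + suc p) b (m≤n+m (suc p) k) (posʳ (k + suc p) b h′))
    strip zero b (y ∷ ys) (_ ◂ _ ◂ adm) s≤ = better-step (b ∷ y ∷ ys) (rec b y ys adm (≤-trans (m≤n+m _ (suc p)) s≤))
    strip (suc k) b (y ∷ ys) adm s≤ with balance (k + suc p) b y ys (m≤n+m (suc p) k) adm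
    ... | b′ , zs , adm′ , s≡ , σ≡ , w≤ = better-trans (1 ∷ k + suc p ∷ b′ ∷ zs) (1 ∷ suc k + suc p ∷ b ∷ y ∷ ys) (cong suc s≡′) σ≡ w≤
      (strip k b′ zs adm′ (≤-trans (≤-reflexive s≡′) s≤))
      where
      s≡′ : k + suc p + (b′ + sum zs) ≡ suc (k + suc p + (b + (y + sum ys)))
      s≡′ = trans (cong (k + suc p +_) s≡) (+-suc (k + suc p) _)

  canonicalise : ∀ f x y ys → Adm (x ∷ y ∷ ys) → sum (x ∷ y ∷ ys) ≤ f → Better (x ∷ y ∷ ys)
  canonicalise f x y [] (h ◂ _) _ = canon⇒better (two x y h)
  canonicalise f 0 y (z ∷ zs) (() ◂ _) _
  canonicalise (suc f) 1 y (z ∷ zs) adm (s≤s s≤) =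
    subst (λ c → Better (1 ∷ c ∷ z ∷ zs)) y≡
      (Recursion.strip f (canonicalise f) (y ∸ suc p) z zs
        (subst (λ c → Adm (1 ∷ c ∷ z ∷ zs)) (sym y≡) adm)
        (subst (λ c → c + (z + sum zs) ≤ f) (sym y≡) s≤))
    where
    y≡ : y ∸ suc p + suc p ≡ y
    y≡ = m∸n+n≡m (≤-trans (Linked.head adm) (≤-reflexive (*-identityˡ y)))
  canonicalise f (suc (suc b)) c (d ∷ rest) adm _ = wide b c d rest adm

  -- Monotonicity of the weight on canonical sequences

  canon-sum : ∀ {cs} → Canon cs → 1 ≤ sum cs
  canon-sum (two a b h)       = ≤-trans (posˡ a b h) (m≤m+n a _)
  canon-sum (three _ _ _ _)   = s≤s z≤n
  canon-sum (extra _ _ _)     = s≤s z≤n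
  canon-sum (step _)          = s≤s z≤n

  canon-weight : ∀ {cs} → Canon cs → 1 ≤ weight cs
  canon-weight (two a b h)     = ≤-trans (posʳ a b h) (≤-trans (m≤m+n b 0) (≤-trans (m≤m+n (b + 0) _) (m≤m+n _ _)))
  canon-weight (three a b h _) = ≤-trans (≤-trans (≤-trans (s≤s z≤n) h) (m≤m+n a (b + 0))) (≤-trans (m≤m+n (a + (b + 0)) _) (m≤m+n _ _))
  canon-weight (extra a _ h)   = ≤-trans (≤-trans (≤-trans (s≤s z≤n) h) (m≤m+n a 1)) (≤-trans (m≤m+n (a + 1) _) (m≤m+n _ _))
  canon-weight (step _)        = s≤s z≤n

  -- For a fixed sum, `σ` never decreases in the order `two`, `extra`, `three`, `step`, which
  -- refutes the cases in reverse order. Two sequences of type `extra` and equal sum coincide. Two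
  -- of type `step` compare through their suffixes, and the other cases are linear inequalities.
  canon-mono : ∀ {cs ds} → Canon cs → Canon ds → sum cs ≡ sum ds → σ cs < σ ds → weight cs < weight ds
  canon-mono (two a b _) (two a′ b′ _) _ h = arith a b a′ b′ h
    where
    arith : ∀ a b a′ b′ → suc (b + 0 + 0) ≤ b′ + 0 + 0 →
            suc (suc p * (b + 0) + (a * 0 + (b * 0 + 0))) ≤ suc p * (b′ + 0) + (a′ * 0 + (b′ * 0 + 0))
    arith a b a′ b′ h = lin p (suc p ⊛ h) (solve (p ∷ a ∷ b ∷ a′ ∷ b′ ∷ []))
  canon-mono (two a b ab) (three a′ b′ _ 1≤b′) e _ = arith a b a′ b′ (posˡ a b ab) 1≤b′ (≤-reflexive e)
    where
    arith : ∀ a b a′ b′ → 1 ≤ a → 1 ≤ b′ → a + (b + 0) ≤ 1 + (a′ + (b′ + 0)) →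
            suc (suc p * (b + 0) + (a * 0 + (b * 0 + 0))) ≤
            suc p * (a′ + (b′ + 0)) + (1 * (b′ + 0) + (a′ * 0 + (b′ * 0 + 0)))
    arith a b a′ b′ h₁ h₂ e = lin 0 (suc p ⊛ (h₁ ⊹ e) ⊹ h₂) (solve (p ∷ a ∷ b ∷ a′ ∷ b′ ∷ []))
  canon-mono (two a b ab) (extra a′ _ _) _ l = arith a b a′ l
    where
    arith : ∀ a b a′ → suc (b + 0 + 0) ≤ a′ + 1 + (1 + 0) →
            suc (suc p * (b + 0) + (a * 0 + (b * 0 + 0))) ≤ suc p * (a′ + 1) + (2 * 1 + (a′ * 0 + (1 * 0 + 0)))
    arith a b a′ l = lin 1 (suc p ⊛ l) (solve (p ∷ a ∷ b ∷ a′ ∷ []))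
  canon-mono (two a b ab) (step {ds} d) e _ =
    arith a b (sum ds) (sum (drop 1 ds)) (far ds) (posˡ a b ab) (canon-sum d) (≤-reflexive e)
    where
    arith : ∀ a b S D F → 1 ≤ a → 1 ≤ S → a + (b + 0) ≤ 1 + (suc p + S) →
            suc (suc p * (b + 0) + (a * 0 + (b * 0 + 0))) ≤
            suc p * (suc p + S) + (1 * S + (suc p * D + F))
    arith a b S D F h₁ h₂ e = lin (suc p * D + F) (suc p ⊛ (h₁ ⊹ e) ⊹ h₂) (solve (p ∷ a ∷ b ∷ S ∷ D ∷ F ∷ []))
  canon-mono (three a b _ _) (two a′ b′ h) e l = ⊥-elim (1+n≰n (arith a b a′ b′ (posˡ a′ b′ h) (≤-reflexive (sym e)) l))
    where
    arith : ∀ a b a′ b′ → 1 ≤ a′ → a′ + (b′ + 0) ≤ 1 + (a + (b + 0)) →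
            suc (a + (b + 0) + (b + 0 + 0)) ≤ b′ + 0 + 0 → 1 ≤ 0
    arith a b a′ b′ h₁ e l = lin b (h₁ ⊹ e ⊹ l) (solve (a ∷ b ∷ a′ ∷ b′ ∷ []))
  canon-mono (three a b _ _) (three a′ b′ _ _) e l = arith a b a′ b′ (≤-reflexive e) l
    where
    arith : ∀ a b a′ b′ → 1 + (a + (b + 0)) ≤ 1 + (a′ + (b′ + 0)) →
            suc (a + (b + 0) + (b + 0 + 0)) ≤ a′ + (b′ + 0) + (b′ + 0 + 0) →
            suc (suc p * (a + (b + 0)) + (1 * (b + 0) + (a * 0 + (b * 0 + 0)))) ≤
            suc p * (a′ + (b′ + 0)) + (1 * (b′ + 0) + (a′ * 0 + (b′ * 0 + 0)))
    arith a b a′ b′ e l = lin 0 (p ⊛ e ⊹ l) (solve (p ∷ a ∷ b ∷ a′ ∷ b′ ∷ []))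
  canon-mono (three a b ha _) (extra a′ _ _) e l = ⊥-elim (1+n≰n (arith a b a′ (≤-reflexive (sym e)) l))
    where
    arith : ∀ a b a′ → 2 + (a′ + 1) ≤ 1 + (a + (b + 0)) →
            suc (a + (b + 0) + (b + 0 + 0)) ≤ a′ + 1 + (1 + 0) → 1 ≤ 0
    arith a b a′ e l = lin b (e ⊹ l) (solve (a ∷ b ∷ a′ ∷ []))
  canon-mono (three a b l≤a _) (step {ds} d) e _ =
    arith a b (sum ds) (weight ds) l≤a (canon-weight d) (≤-reflexive e)
    where
    arith : ∀ a b S W → suc p ≤ a → 1 ≤ W → 1 + (a + (b + 0)) ≤ 1 + (suc p + S) →
            suc (suc p * (a + (b + 0)) + (1 * (b + 0) + (a * 0 + (b * 0 + 0)))) ≤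
            suc p * (suc p + S) + (1 * S + W)
    arith a b S W h₁ h₂ e = lin 0 (suc (suc p) ⊛ e ⊹ h₁ ⊹ h₂) (solve (p ∷ a ∷ b ∷ S ∷ W ∷ []))
  canon-mono (extra a _ _) (two a′ b′ h) e l = ⊥-elim (1+n≰n (arith a a′ b′ (posˡ a′ b′ h) (≤-reflexive (sym e)) l))
    where
    arith : ∀ a a′ b′ → 1 ≤ a′ → a′ + (b′ + 0) ≤ 2 + (a + 1) → suc (a + 1 + (1 + 0)) ≤ b′ + 0 + 0 → 1 ≤ 0
    arith a a′ b′ h₁ e l = lin 0 (h₁ ⊹ e ⊹ l) (solve (a ∷ a′ ∷ b′ ∷ []))
  canon-mono (extra a p≡2 _) (three a′ b′ _ 1≤b′) e _ = arith a a′ b′ (≤-reflexive (sym p≡2)) 1≤b′ (≤-reflexive e)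
    where
    arith : ∀ a a′ b′ → 2 ≤ p → 1 ≤ b′ → 2 + (a + 1) ≤ 1 + (a′ + (b′ + 0)) →
            suc (suc p * (a + 1) + (2 * 1 + (a * 0 + (1 * 0 + 0)))) ≤
            suc p * (a′ + (b′ + 0)) + (1 * (b′ + 0) + (a′ * 0 + (b′ * 0 + 0)))
    arith a a′ b′ h₁ h₂ e = lin 1 (h₁ ⊹ h₂ ⊹ suc p ⊛ e) (solve (p ∷ a ∷ a′ ∷ b′ ∷ []))
  canon-mono (extra a _ _) (extra a′ _ _) e l = ⊥-elim (1+n≰n (arith a a′ (≤-reflexive (sym e)) l))
    where
    arith : ∀ a a′ → 2 + (a′ + 1) ≤ 2 + (a + 1) → suc (a + 1 + (1 + 0)) ≤ a′ + 1 + (1 + 0) → 1 ≤ 0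
    arith a a′ e l = lin 0 (e ⊹ l) (solve (a ∷ a′ ∷ []))
  canon-mono (extra a p≡2 _) (step {ds} d) e _ = arith a (sum ds) (weight ds) (≤-reflexive (sym p≡2)) (canon-sum d) (≤-reflexive e)
    where
    arith : ∀ a S W → 2 ≤ p → 1 ≤ S → 2 + (a + 1) ≤ 1 + (suc p + S) →
            suc (suc p * (a + 1) + (2 * 1 + (a * 0 + (1 * 0 + 0)))) ≤ suc p * (suc p + S) + (1 * S + W)
    arith a S W h₁ h₂ e = lin (suc W) (h₁ ⊹ h₂ ⊹ suc p ⊛ e) (solve (p ∷ a ∷ S ∷ W ∷ []))
  canon-mono (step {cs} c) (two a b h) e l =
    ⊥-elim (1+n≰n (arith (sum cs) (σ cs) a b (posˡ a b h) (≤-reflexive (sym e)) l))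
    where
    arith : ∀ S u a b → 1 ≤ a → a + (b + 0) ≤ 1 + (suc p + S) → suc (suc p + S + (S + u)) ≤ b + 0 + 0 → 1 ≤ 0
    arith S u a b h₁ e l = lin (S + u) (h₁ ⊹ e ⊹ l) (solve (p ∷ S ∷ u ∷ a ∷ b ∷ []))
  canon-mono (step {cs} c) (three a b l≤a _) e l =
    ⊥-elim (1+n≰n (arith (sum cs) (σ cs) a b l≤a (≤-reflexive (sym e)) l))
    where
    arith : ∀ S u a b → suc p ≤ a → 1 + (a + (b + 0)) ≤ 1 + (suc p + S) →
            suc (suc p + S + (S + u)) ≤ a + (b + 0) + (b + 0 + 0) → 1 ≤ 0
    arith S u a b h₁ e l = lin u (h₁ ⊹ 2 ⊛ e ⊹ l) (solve (p ∷ S ∷ u ∷ a ∷ b ∷ []))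
  canon-mono (step {cs} c) (extra a _ _) e l =
    ⊥-elim (1+n≰n (arith (sum cs) (σ cs) a (≤-reflexive (sym e)) l))
    where
    arith : ∀ S u a → 2 + (a + 1) ≤ 1 + (suc p + S) →
            suc (suc p + S + (S + u)) ≤ a + 1 + (1 + 0) → 1 ≤ 0
    arith S u a e l = lin (S + u) (e ⊹ l) (solve (p ∷ S ∷ u ∷ a ∷ []))
  canon-mono (step {cs} c) (step {ds} d) e l =
    arith (sum cs) (sum ds) (weight cs) (weight ds) S≡ (canon-mono c d S≡ (arith′ (sum cs) (sum ds) (σ cs) (σ ds) S≡ l))
    where
    S≡ : sum cs ≡ sum ds
    S≡ = +-cancelˡ-≡ (2 + p) (sum cs) (sum ds) e
    arith : ∀ S T W X → S ≡ T → W < X → suc p * (suc p + S) + (1 * S + W) < suc p * (suc p + T) + (1 * T + X)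
    arith S _ W X refl h = +-monoʳ-< (suc p * (suc p + S)) (+-monoʳ-< (1 * S) h)
    arith′ : ∀ S T u v → S ≡ T → suc p + S + (S + u) < suc p + T + (T + v) → u < v
    arith′ S _ u v refl h = +-cancelˡ-< S u v (+-cancelˡ-< (suc p + S) (S + u) (S + v) h)

-- Finite sums and layers

private variable
  n : ℕ

∑-mono : {f g : Fin n → ℕ} → (∀ i → f i ≤ g i) → ∑ f ≤ ∑ g
∑-mono {zero}  h = z≤n
∑-mono {suc n} h = h Fin.zero ⊹ ∑-mono (h ∘ Fin.suc)

∑∑-mono : {f g : Fin n → Fin n → ℕ} → (∀ i j → f i j ≤ g i j) →
          ∑ (λ i → ∑ (f i)) ≤ ∑ λ i → ∑ (g i)
∑∑-mono h = ∑-mono λ i → ∑-mono (h i)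

∑-cong : {f g : Fin n → ℕ} → (∀ i → f i ≡ g i) → ∑ f ≡ ∑ g
∑-cong = Sum.sum-cong-≗

∑∑-cong : {f g : Fin n → Fin n → ℕ} → (∀ i j → f i j ≡ g i j) →
          ∑ (λ i → ∑ (f i)) ≡ ∑ λ i → ∑ (g i)
∑∑-cong h = ∑-cong λ i → ∑-cong (h i)

∑-+ : (f g : Fin n → ℕ) → ∑ (λ i → f i + g i) ≡ ∑ f + ∑ g
∑-+ = Sum.∑-distrib-+

∑∑-+ : (f g : Fin n → Fin n → ℕ) →
       ∑ (λ i → ∑ λ j → f i j + g i j) ≡ ∑ (λ i → ∑ (f i)) + ∑ λ i → ∑ (g i)
∑∑-+ f g = trans (∑-cong λ i → ∑-+ (f i) (g i)) (∑-+ (∑ ∘ f) (∑ ∘ g))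

∑-const : ∀ n k → ∑ {n} (λ _ → k) ≡ n * k
∑-const zero    k = refl
∑-const (suc n) k = cong (k +_) (∑-const n k)

∑-zero : {f : Fin n → ℕ} → (∀ i → f i ≡ 0) → ∑ f ≡ 0
∑-zero {n} h = trans (∑-cong h) (trans (∑-const n 0) (*-zeroʳ n))

𝟙-yes : {A : Set} (a? : Dec A) → A → 𝟙 a? ≡ 1
𝟙-yes a? a rewrite dec-true a? a = refl

𝟙-no : {A : Set} (a? : Dec A) → ¬ A → 𝟙 a? ≡ 0
𝟙-no a? ¬a rewrite dec-false a? ¬a = refl

𝟙-≤ : {A : Set} {m : ℕ} (a? : Dec A) → (A → 1 ≤ m) → 𝟙 a? ≤ m
𝟙-≤ (no _)  h = z≤n
𝟙-≤ (yes a) h = h a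

δ : Fin n → Fin n → ℕ
δ u v = 𝟙 (u Fin.≟ v)

∑-δ : (u : Fin n) (g : Fin n → ℕ) → ∑ (λ v → δ u v * g v) ≡ g u
∑-δ {suc n} Fin.zero    g =
  trans (cong (1 * g Fin.zero +_) (∑-zero {f = λ v → δ Fin.zero (Fin.suc v) * g (Fin.suc v)} λ v → refl)) (trans (+-identityʳ _) (*-identityˡ _))
∑-δ {suc n} (Fin.suc u) g =
  trans (∑-cong λ v → cong (_* g (Fin.suc v)) (δ-suc u v)) (∑-δ u (g ∘ Fin.suc))
  where
  δ-suc : ∀ {n} (u v : Fin n) → δ (Fin.suc u) (Fin.suc v) ≡ δ u v
  δ-suc u v with u Fin.≟ v
  ... | yes _ = refl
  ... | no _  = refl

∑-δ₁ : (u : Fin n) → ∑ (δ u) ≡ 1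
∑-δ₁ u = trans (∑-cong λ v → sym (*-identityʳ (δ u v))) (∑-δ u (const 1))

∑∑-δ : ∀ n → ∑ {n} (λ u → ∑ (δ u)) ≡ n
∑∑-δ n = trans (∑-cong {n} ∑-δ₁) (trans (∑-const n 1) (*-identityʳ n))

-- Row `u` and column `v` share only the entry `M u v`.
row+column : (M : Fin n → Fin n → ℕ) (u v : Fin n) →
             ∑ (M u) + ∑ (λ x → M x v) ≤ ∑ (λ x → ∑ (M x)) + M u v
row+column {n} M u v = ≤-trans (≤-reflexive (sym lhs)) (≤-trans (∑∑-mono {n} bound) (≤-reflexive rhs))
  where
  lhs : ∑ {n} (λ x → ∑ λ y → δ u x * M x y + δ v y * M x y) ≡ ∑ (M u) + ∑ (λ x → M x v)
  lhs = trans (∑∑-+ {n} _ _) (cong₂ _+_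
    (trans (∑-cong {n} λ x → sym (Sum.*-distribˡ-sum (δ u x) (M x))) (∑-δ u (∑ ∘ M)))
    (∑-cong {n} λ x → ∑-δ v (M x)))
  rhs : ∑ {n} (λ x → ∑ λ y → M x y + δ u x * (δ v y * M x y)) ≡ ∑ (λ x → ∑ (M x)) + M u v
  rhs = trans (∑∑-+ {n} _ _) (cong (∑ (λ x → ∑ (M x)) +_)
    (trans (∑-cong {n} λ x → trans (sym (Sum.*-distribˡ-sum (δ u x) (λ y → δ v y * M x y)))
                               (cong (δ u x *_) (∑-δ v (M x))))
           (∑-δ u (λ x → M x v))))
  bound : ∀ x y → δ u x * M x y + δ v y * M x y ≤ M x y + δ u x * (δ v y * M x y)
  bound x y with u Fin.≟ x | v Fin.≟ y
  ... | yes _ | yes _ = ≤-reflexive (arith (M x y))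
    where
    arith : ∀ m → 1 * m + 1 * m ≡ m + 1 * (1 * m)
    arith = solve-∀
  ... | yes _ | no _  = ≤-reflexive (arith (M x y))
    where
    arith : ∀ m → 1 * m + 0 * m ≡ m + 1 * (0 * m)
    arith = solve-∀
  ... | no _  | yes _ = ≤-reflexive (arith (M x y))
    where
    arith : ∀ m → 0 * m + 1 * m ≡ m + 0 * (1 * m)
    arith = solve-∀
  ... | no _  | no _  = z≤n

-- Sums over layers

wsum : List ℕ → (ℕ → ℕ) → ℕ
wsum []       g = 0
wsum (x ∷ xs) g = x * g 0 + wsum xs (g ∘ suc)

wsum-cong : ∀ xs {f g} → (∀ i → f i ≡ g i) → wsum xs f ≡ wsum xs g
wsum-cong []       h = refl
wsum-cong (x ∷ xs) h = cong₂ _+_ (cong (x *_) (h 0)) (wsum-cong xs (h ∘ suc))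

wsum-+ : ∀ xs f g → wsum xs (λ i → f i + g i) ≡ wsum xs f + wsum xs g
wsum-+ []       f g = refl
wsum-+ (x ∷ xs) f g = trans (cong (x * (f 0 + g 0) +_) (wsum-+ xs (f ∘ suc) (g ∘ suc)))
  (arith x (f 0) (g 0) (wsum xs (f ∘ suc)) (wsum xs (g ∘ suc)))
  where
  arith : ∀ x a b c d → x * (a + b) + (c + d) ≡ x * a + c + (x * b + d)
  arith = solve-∀

wsum-1 : ∀ xs → wsum xs (const 1) ≡ sum xs
wsum-1 []       = refl
wsum-1 (x ∷ xs) = cong₂ _+_ (*-identityʳ x) (wsum-1 xs)

wsum-id : ∀ xs → wsum xs id ≡ σ xs
wsum-id []       = refl
wsum-id (x ∷ xs) = trans (cong (_+ wsum xs suc) (*-zeroʳ x))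
  (trans (wsum-+ xs (const 1) id) (cong₂ _+_ (wsum-1 xs) (wsum-id xs)))

-- The indicators of `j = i`, `j = i + 1` and `j ≥ i + 2`.
same next apart : ℕ → ℕ → ℕ
same zero    zero    = 1
same zero    (suc j) = 0
same (suc i) zero    = 0
same (suc i) (suc j) = same i j
next zero    zero          = 0
next zero    (suc zero)    = 1
next zero    (suc (suc j)) = 0
next (suc i) zero          = 0
next (suc i) (suc j)       = next i j
apart zero    zero          = 0
apart zero    (suc zero)    = 0
apart zero    (suc (suc j)) = 1
apart (suc i) zero          = 0
apart (suc i) (suc j)       = apart i j

trichotomy : ∀ i j → same i j + (next i j + next j i) + (apart i j + apart j i) ≡ 1
trichotomy zero          zero          = refl
trichotomy zero          (suc zero)    = refl
trichotomy zero          (suc (suc j)) = refl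
trichotomy (suc zero)    zero          = refl
trichotomy (suc (suc i)) zero          = refl
trichotomy (suc i)       (suc j)       = trichotomy i j

same-refl : ∀ i → same i i ≡ 1
same-refl zero    = refl
same-refl (suc i) = same-refl i

-- One plus the jump `j - i`, written without subtraction: it is 1 inside a layer, 2 for a step
-- forward and at most 0 for a step backward.
ascent : ∀ i j → j ≤ suc i → suc j ≤ i + (same i j + 2 * next i j)
ascent zero    zero          _ = s≤s z≤n
ascent zero    (suc zero)    _ = s≤s (s≤s z≤n)
ascent zero    (suc (suc j)) (s≤s ())
ascent (suc i) zero          _ = s≤s z≤n
ascent (suc i) (suc j)       h = s≤s (ascent i j (≤-pred h))

apart-near : ∀ i j → j ≤ suc i → apart i j ≡ 0
apart-near zero    zero          _ = refl
apart-near zero    (suc zero)    _ = refl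
apart-near zero    (suc (suc j)) (s≤s ())
apart-near (suc i) zero          _ = refl
apart-near (suc i) (suc j)       h = apart-near i j (≤-pred h)

apart-far : ∀ i j → ¬ j ≤ suc i → apart i j ≡ 1
apart-far zero    zero          h = contradiction z≤n h
apart-far zero    (suc zero)    h = contradiction (s≤s z≤n) h
apart-far zero    (suc (suc j)) _ = refl
apart-far (suc i) zero          h = contradiction z≤n h
apart-far (suc i) (suc j)       h = apart-far i j (h ∘ s≤s)

wsum-apart : ∀ xs → wsum xs (λ i → wsum xs (apart i)) ≡ far xs
wsum-apart []       = refl
wsum-apart (x ∷ xs) = cong₂ _+_
  (cong (x *_) (trans (cong (_+ wsum xs (apart 0 ∘ suc)) (*-zeroʳ x)) (beyond xs)))
  (trans (wsum-cong xs λ i → cong (_+ wsum xs (apart i)) (*-zeroʳ x)) (wsum-apart xs))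
  where
  beyond : ∀ xs → wsum xs (apart 0 ∘ suc) ≡ sum (drop 1 xs)
  beyond []       = refl
  beyond (y ∷ ys) = trans (cong (_+ wsum ys (const 1)) (*-zeroʳ y)) (wsum-1 ys)

-- This says that `as` lists the numbers of vertices at the levels 0, 1, ... of `ℓ`. Quantifying
-- over all `g` lets every sum over vertices be read off from `as`.
Layers : (Fin n → ℕ) → List ℕ → Set
Layers ℓ as = ∀ g → ∑ (g ∘ ℓ) ≡ wsum as g

module Layered {ℓ : Fin n → ℕ} {as : List ℕ} (layers : Layers ℓ as) where

  order : n ≡ sum as
  order = trans (sym (trans (∑-const n 1) (*-identityʳ n))) (trans (layers (const 1)) (wsum-1 as))

  total : ∑ ℓ ≡ σ as
  total = trans (layers id) (wsum-id as)

  pairs : (F : ℕ → ℕ → ℕ) → ∑ {n} (λ u → ∑ λ v → F (ℓ u) (ℓ v)) ≡ wsum as λ i → wsum as (F i)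
  pairs F = trans (∑-cong {n} λ u → layers (F (ℓ u))) (layers λ i → wsum as (F i))

  ∑apart : ∑ {n} (λ u → ∑ λ v → apart (ℓ u) (ℓ v)) ≡ far as
  ∑apart = trans (pairs apart) (wsum-apart as)

  ∑∑1 : ∑ {n} (λ _ → ∑ {n} λ _ → 1) ≡ n * n
  ∑∑1 = trans (∑-cong {n} λ _ → trans (∑-const n 1) (*-identityʳ n)) (∑-const n n)

  ∑apart₂ : ∑ {n} (λ u → ∑ λ v → apart (ℓ u) (ℓ v) + apart (ℓ v) (ℓ u)) ≡ 2 * far as
  ∑apart₂ = trans (∑∑-+ {n} _ _) (trans
    (cong₂ _+_ ∑apart (trans (Sum.∑-comm {n} {n} λ u v → apart (ℓ v) (ℓ u)) ∑apart))
    (cong (far as +_) (sym (+-identityʳ _))))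

  -- `ascent` is summed over all arcs, and the jumps cancel by the balance hypothesis. The diagonal,
  -- counted by `same` but free of arcs, accounts for the term `n`. Interchanging the vertices in
  -- one copy of `next` turns the upper bound into the number of ordered pairs that are not apart.
  size-bound : (D : Digraph (Fin n)) → (∀ {u v} → Arc D u v → ℓ v ≤ suc (ℓ u)) →
               ∑ {n} (λ u → ∑ λ v → 𝟙 (arc? D u v) * ℓ v) ≡ ∑ {n} (λ u → ∑ λ v → 𝟙 (arc? D u v) * ℓ u) →
               size D + n + 2 * far as ≤ n * n
  size-bound D up balanced = +-cancelʳ-≤ B (size D + n + 2 * far as) (n * n) (begin
    size D + n + 2 * far as + B   ≡⟨ cong₂ (λ x y → size D + x + 2 * far as + y) (sym (∑∑-δ n)) (sym balanced) ⟩
    size D + Δ + 2 * far as + A   ≡⟨ arith₁ (size D) Δ (2 * far as) A ⟩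
    size D + A + Δ + 2 * far as   ≡⟨ cong (λ x → x + Δ + 2 * far as) (sym (∑∑-+ {n} _ _)) ⟩
    ∑ {n} (λ u → ∑ λ v → 𝟙 (arc? D u v) + 𝟙 (arc? D u v) * ℓ v) + Δ + 2 * far as
                                  ≡⟨ cong (_+ 2 * far as) (sym (∑∑-+ {n} _ _)) ⟩
    ∑ {n} (λ u → ∑ λ v → 𝟙 (arc? D u v) + 𝟙 (arc? D u v) * ℓ v + δ u v) + 2 * far as
                                  ≤⟨ ∑∑-mono {n} pointwise ⊹ ≤-refl ⟩
    ∑ {n} (λ u → ∑ λ v → 𝟙 (arc? D u v) * ℓ u + (same (ℓ u) (ℓ v) + 2 * next (ℓ u) (ℓ v))) + 2 * far as
                                  ≡⟨ cong (_+ 2 * far as) (∑∑-+ {n} _ _) ⟩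
    B + ∑ {n} (λ u → ∑ λ v → same (ℓ u) (ℓ v) + 2 * next (ℓ u) (ℓ v)) + 2 * far as
                                  ≡⟨ cong (λ x → B + x + 2 * far as) symmetrise ⟩
    B + C + 2 * far as            ≡⟨ cong (B + C +_) (sym ∑apart₂) ⟩
    B + C + ∑ {n} (λ u → ∑ λ v → apart (ℓ u) (ℓ v) + apart (ℓ v) (ℓ u))
                                  ≡⟨ trans (+-assoc B C _) (cong (B +_) (sym (∑∑-+ {n} _ _))) ⟩
    B + ∑ {n} (λ u → ∑ λ v → same (ℓ u) (ℓ v) + (next (ℓ u) (ℓ v) + next (ℓ v) (ℓ u))
                         + (apart (ℓ u) (ℓ v) + apart (ℓ v) (ℓ u)))
                                  ≡⟨ cong (B +_) (trans (∑∑-cong {n} λ u v → trichotomy (ℓ u) (ℓ v)) ∑∑1) ⟩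
    B + n * n                     ≡⟨ +-comm B (n * n) ⟩
    n * n + B                     ∎)
    where
    open ≤-Reasoning
    Δ = ∑ {n} λ u → ∑ (δ u)
    A = ∑ λ u → ∑ λ v → 𝟙 (arc? D u v) * ℓ v
    B = ∑ λ u → ∑ λ v → 𝟙 (arc? D u v) * ℓ u
    C = ∑ λ u → ∑ λ v → same (ℓ u) (ℓ v) + (next (ℓ u) (ℓ v) + next (ℓ v) (ℓ u))
    arith₁ : ∀ s d f a → s + d + f + a ≡ s + a + d + f
    arith₁ = solve-∀
    symmetrise : ∑ {n} (λ u → ∑ λ v → same (ℓ u) (ℓ v) + 2 * next (ℓ u) (ℓ v)) ≡ C
    symmetrise = trans (∑∑-+ {n} _ _) (trans (cong (∑ {n} (λ u → ∑ λ v → same (ℓ u) (ℓ v)) +_)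
      (trans (trans (∑∑-cong {n} λ u v → cong (next (ℓ u) (ℓ v) +_) (+-identityʳ _)) (∑∑-+ {n} _ _))
        (trans (cong (∑ {n} (λ u → ∑ λ v → next (ℓ u) (ℓ v)) +_) (Sum.∑-comm {n} {n} λ u v → next (ℓ u) (ℓ v)))
          (sym (∑∑-+ {n} _ _)))))
      (sym (∑∑-+ {n} _ _)))
    pointwise : ∀ u v → 𝟙 (arc? D u v) + 𝟙 (arc? D u v) * ℓ v + δ u v ≤
                        𝟙 (arc? D u v) * ℓ u + (same (ℓ u) (ℓ v) + 2 * next (ℓ u) (ℓ v))
    pointwise u v with arc? D u v | u Fin.≟ v
    ... | yes a | yes u≡v = contradiction a (Digraph.irrefl D u≡v)
    ... | yes a | no _    = subst₂ _≤_ (arith (ℓ v)) (cong (_+ (same (ℓ u) (ℓ v) + 2 * next (ℓ u) (ℓ v))) (sym (*-identityˡ (ℓ u)))) (ascent (ℓ u) (ℓ v) (up a))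
      where
      arith : ∀ x → suc x ≡ 1 + 1 * x + 0
      arith = solve-∀
    ... | no _  | no _    = z≤n
    ... | no _  | yes refl = ≤-trans (≤-reflexive (sym (same-refl (ℓ u)))) (m≤m+n _ _)

  size-exact : (D : Digraph (Fin n)) →
               (∀ {u v} → Arc D u v → u ≢ v × ℓ v ≤ suc (ℓ u) × ℓ u ≤ suc (ℓ v)) →
               (∀ {u v} → u ≢ v → ℓ v ≤ suc (ℓ u) → ℓ u ≤ suc (ℓ v) → Arc D u v) →
               size D + n + 2 * far as ≡ n * n
  size-exact D to from = begin
    size D + n + 2 * far as
      ≡⟨ cong₂ (λ x y → size D + x + y) (sym (∑∑-δ n)) (sym ∑apart₂) ⟩
    size D + ∑ {n} (λ u → ∑ (δ u)) + ∑ {n} (λ u → ∑ λ v → apart (ℓ u) (ℓ v) + apart (ℓ v) (ℓ u))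
      ≡⟨ cong (_+ ∑ {n} (λ u → ∑ λ v → apart (ℓ u) (ℓ v) + apart (ℓ v) (ℓ u))) (sym (∑∑-+ {n} _ _)) ⟩
    ∑ {n} (λ u → ∑ λ v → 𝟙 (arc? D u v) + δ u v) + ∑ {n} (λ u → ∑ λ v → apart (ℓ u) (ℓ v) + apart (ℓ v) (ℓ u))
      ≡⟨ sym (∑∑-+ {n} _ _) ⟩
    ∑ {n} (λ u → ∑ λ v → 𝟙 (arc? D u v) + δ u v + (apart (ℓ u) (ℓ v) + apart (ℓ v) (ℓ u)))
      ≡⟨ ∑∑-cong {n} pointwise ⟩
    ∑ {n} (λ _ → ∑ {n} λ _ → 1)
      ≡⟨ ∑∑1 ⟩
    n * n ∎
    where
    open ≡-Reasoning
    pointwise : ∀ u v → 𝟙 (arc? D u v) + δ u v + (apart (ℓ u) (ℓ v) + apart (ℓ v) (ℓ u)) ≡ 1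
    pointwise u v with arc? D u v | u Fin.≟ v
    ... | yes a | yes u≡v = contradiction a (Digraph.irrefl D u≡v)
    ... | yes a | no _    = let _ , h , h′ = to a in
                            cong suc (cong₂ _+_ (apart-near (ℓ u) (ℓ v) h) (apart-near (ℓ v) (ℓ u) h′))
    ... | no _  | yes refl = cong suc (cong₂ _+_ (apart-near (ℓ u) (ℓ u) (n≤1+n _)) (apart-near (ℓ u) (ℓ u) (n≤1+n _)))
    ... | no ¬a | no u≢v with ℓ v ≤? suc (ℓ u) | ℓ u ≤? suc (ℓ v)
    ...   | yes h | yes h′ = contradiction (from u≢v h h′) ¬a
    ...   | yes h | no h′  = cong₂ _+_ (apart-near (ℓ u) (ℓ v) h) (apart-far (ℓ v) (ℓ u) h′)
    ...   | no h  | yes h′ = cong₂ _+_ (apart-far (ℓ u) (ℓ v) h) (apart-near (ℓ v) (ℓ u) h′)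
    ...   | no h  | no h′  = contradiction (<-trans (n<1+n _) (≰⇒> h′)) (<-asym (<-trans (n<1+n _) (≰⇒> h)))

-- Walks, distances and circuits

infixr 5 _⟶_

data Walk {V : Set} (D : Digraph V) : V → V → ℕ → Set where
  stop : ∀ {u} → Walk D u u 0
  _⟶_  : ∀ {u v w k} → Arc D u v → Walk D v w k → Walk D u w (suc k)

module _ {V : Set} {D : Digraph V} where

  infixr 5 _⟶⟶_

  _⟶⟶_ : ∀ {u v w j k} → Walk D u v j → Walk D v w k → Walk D u w (j + k)
  stop    ⟶⟶ q = q
  (a ⟶ p) ⟶⟶ q = a ⟶ (p ⟶⟶ q)

  snoc : ∀ {u v w k} → Walk D u v k → Arc D v w → Walk D u w (suc k)
  snoc stop    b = b ⟶ stop
  snoc (a ⟶ p) b = a ⟶ snoc p b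

  climb : {ℓ : V → ℕ} → (∀ {u v} → Arc D u v → ℓ v ≤ suc (ℓ u)) →
          ∀ {u v k} → Walk D u v k → ℓ v ≤ k + ℓ u
  climb up stop = ≤-refl
  climb {ℓ} up (_⟶_ {u} {v} {w} {k} a p) =
    ≤-trans (climb up p) (≤-trans (+-monoʳ-≤ k (up a)) (≤-reflexive (+-suc k (ℓ u))))

  path⇒walk : ∀ {k} {u v} (ws : Vec V (suc k)) → IsWalk D u v ws → Walk D u v k
  path⇒walk (x Vec.∷ Vec.[])         (_ , refl , refl) = stop
  path⇒walk (x Vec.∷ xs@(_ Vec.∷ _)) (r VLinked.∷ rs , refl , e) = r ⟶ path⇒walk xs (rs , refl , e)

module _ {D : Digraph (Fin n)} where

  -- If `u` lies on the path, the part of the path from `u` on is the shortcut.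
  avoid-or-shortcut : ∀ {k} u {v} (ws : Vec (Fin n) (suc k)) → IsPath D (Vec.head ws) v ws →
                      All.All (u ≢_) ws ⊎ ∃[ j ] j ≤ k × HasPath D u v j
  avoid-or-shortcut u (x Vec.∷ xs) p with u Fin.≟ x
  ... | yes refl = inj₂ (_ , ≤-refl , x Vec.∷ xs , p)
  avoid-or-shortcut u (x Vec.∷ Vec.[]) _ | no u≢x = inj₁ (u≢x All.∷ All.[])
  avoid-or-shortcut u (x Vec.∷ xs@(_ Vec.∷ _)) ((r VLinked.∷ rs , _ , e) , (_ AllPairs.∷ uniq)) | no u≢x
    with avoid-or-shortcut u xs ((rs , refl , e) , uniq)
  ... | inj₁ avoids           = inj₁ (u≢x All.∷ avoids)
  ... | inj₂ (j , j≤k , path) = inj₂ (j , m≤n⇒m≤1+n j≤k , path)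

  walk⇒path : ∀ {u v k} → Walk D u v k → ∃[ j ] j ≤ k × HasPath D u v j
  walk⇒path (stop {u}) = 0 , z≤n , u Vec.∷ Vec.[] , (VLinked.[-] , refl , refl) , (All.[] AllPairs.∷ AllPairs.[])
  walk⇒path (_⟶_ {u} a p) with walk⇒path p
  ... | j , j≤k , ws@(x Vec.∷ xs) , ((rs , refl , e) , uniq) with avoid-or-shortcut u ws ((rs , refl , e) , uniq)
  ...   | inj₁ avoids            = suc j , s≤s j≤k , u Vec.∷ ws , (a VLinked.∷ rs , refl , e) , (avoids AllPairs.∷ uniq)
  ...   | inj₂ (i , i≤j , path) = i , m≤n⇒m≤1+n (≤-trans i≤j j≤k) , path

  walks⇒strong : (∀ u v → ∃ (Walk D u v)) → Strong D
  walks⇒strong walks u v = let j , _ , path = walk⇒path (proj₂ (walks u v)) in j , path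

  strong⇒walks : Strong D → ∀ u v → ∃ (Walk D u v)
  strong⇒walks strong u v = let k , ws , (w , _) = strong u v in k , path⇒walk ws w

module _ (D : Digraph (Fin n)) (strong : Strong D) where

  dist-walk : ∀ u v → Walk D u v (dist D strong u v)
  dist-walk u v with least (hasPath? D u v) (proj₁ (strong u v)) (proj₂ (strong u v))
  ... | _ , (ws , (w , _)) , _ = path⇒walk ws w

  dist-min : ∀ {u v k} → Walk D u v k → dist D strong u v ≤ k
  dist-min {u} {v} w with least (hasPath? D u v) (proj₁ (strong u v)) (proj₂ (strong u v)) | walk⇒path w
  ... | _ , _ , minimal | j , j≤k , path = ≤-trans (minimal path) j≤k

  dist-refl : ∀ u → dist D strong u u ≡ 0
  dist-refl u = n≤0⇒n≡0 (dist-min stop)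

  dist-arc : ∀ u {v w} → Arc D v w → dist D strong u w ≤ suc (dist D strong u v)
  dist-arc u a = dist-min (snoc (dist-walk u _) a)

-- Balance of Eulerian digraphs

count : ∀ {k} → Vec (Fin n × Fin n) k → Fin n → Fin n → ℕ
count Vec.[]             x y = 0
count ((u , v) Vec.∷ es) x y = δ u x * δ v y + count es x y

sumSteps : ∀ {k} {V : Set} → (V → V → ℕ) → Vec (V × V) k → ℕ
sumSteps F Vec.[]             = 0
sumSteps F ((u , v) Vec.∷ es) = F u v + sumSteps F es

sumSteps-count : ∀ {k} (F : Fin n → Fin n → ℕ) (es : Vec (Fin n × Fin n) k) →
                 ∑ {n} (λ x → ∑ {n} λ y → count es x y * F x y) ≡ sumSteps F es
sumSteps-count {n} F Vec.[] = ∑-zero {n} λ x → ∑-zero {n} λ y → refl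
sumSteps-count {n} F ((u , v) Vec.∷ es) = trans
  (∑∑-cong {n} λ x y → trans (*-distribʳ-+ (F x y) (δ u x * δ v y) (count es x y))
                             (cong (_+ count es x y * F x y) (*-assoc (δ u x) (δ v y) (F x y))))
  (trans (∑∑-+ {n} _ _) (cong₂ _+_
    (trans (∑-cong {n} λ x → trans (sym (Sum.*-distribˡ-sum (δ u x) (λ y → δ v y * F x y)))
                                   (cong (δ u x *_) (∑-δ v (F x))))
           (∑-δ u (λ x → F x v)))
    (sumSteps-count F es)))

δδ-no : (u v x y : Fin n) → (u , v) ≢ (x , y) → δ u x * δ v y ≡ 0
δδ-no u v x y ne with u Fin.≟ x | v Fin.≟ y
... | yes refl | yes refl = contradiction refl ne
... | yes _    | no _     = refl
... | no _     | _        = refl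

δδ-yes : (u v : Fin n) → δ u u * δ v v ≡ 1
δδ-yes u v = cong₂ _*_ (𝟙-yes (u Fin.≟ u) refl) (𝟙-yes (v Fin.≟ v) refl)

count-∉ : ∀ {k x y} (es : Vec (Fin n × Fin n) k) → ¬ (x , y) ∈ es → count es x y ≡ 0
count-∉ Vec.[]             _  = refl
count-∉ {x = x} {y} ((u , v) Vec.∷ es) ∉ = cong₂ _+_ (δδ-no u v x y λ e → ∉ (here (sym e))) (count-∉ es (∉ ∘ there))

count-∈ : ∀ {k x y} (es : Vec (Fin n × Fin n) k) → Unique es → (x , y) ∈ es → count es x y ≡ 1
count-∈ ((u , v) Vec.∷ es) (fresh AllPairs.∷ _)    (here refl) =
  cong₂ _+_ (δδ-yes u v) (count-∉ es λ e∈ → All.lookup fresh e∈ refl)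
count-∈ {x = x} {y} ((u , v) Vec.∷ es) (fresh AllPairs.∷ uniq) (there e∈) =
  cong₂ _+_ (δδ-no u v x y λ { refl → All.lookup fresh e∈ refl }) (count-∈ es uniq e∈)

step-arc : ∀ {V : Set} {D : Digraph V} {k x y} (ws : Vec V (suc k)) → VLinked.Linked (Arc D) ws →
           (x , y) ∈ steps ws → Arc D x y
step-arc (u Vec.∷ v Vec.∷ ws) (r VLinked.∷ rs) (here refl) = r
step-arc {D = D} (u Vec.∷ v Vec.∷ ws) (r VLinked.∷ rs) (there e∈)  = step-arc {D = D} (v Vec.∷ ws) rs e∈

telescope : ∀ {V : Set} {k} (f : V → ℕ) (ws : Vec V (suc k)) →
            sumSteps (λ u v → f v) (steps ws) + f (Vec.head ws) ≡
            sumSteps (λ u v → f u) (steps ws) + f (Vec.last ws)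
telescope f (u Vec.∷ Vec.[])      = refl
telescope f (u Vec.∷ v Vec.∷ ws) = begin
  f v + A + f u               ≡⟨ arith (f v) A (f u) ⟩
  f u + (A + f v)             ≡⟨ cong (f u +_) (telescope f (v Vec.∷ ws)) ⟩
  f u + (B + f (Vec.last (v Vec.∷ ws))) ≡⟨ sym (+-assoc (f u) B _) ⟩
  f u + B + f (Vec.last (v Vec.∷ ws)) ∎
  where
  open ≡-Reasoning
  A = sumSteps (λ u v → f v) (steps (v Vec.∷ ws))
  B = sumSteps (λ u v → f u) (steps (v Vec.∷ ws))
  arith : ∀ a b c → a + b + c ≡ c + (b + a)
  arith = solve-∀

-- The circuit uses each arc exactly once, so sums over arcs are sums over its steps, and these
-- telescope around the closed trail. For a level function `f` this says that the jumps sum to 0.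
eulerian-balanced : (D : Digraph (Fin n)) → Eulerian D → (f : Fin n → ℕ) →
                    ∑ {n} (λ u → ∑ {n} λ v → 𝟙 (arc? D u v) * f v) ≡
                    ∑ {n} (λ u → ∑ {n} λ v → 𝟙 (arc? D u v) * f u)
eulerian-balanced {n} D (_ , _ , ws , (linked , _ , closed) , uniq , covers) f = begin
  ∑ {n} (λ u → ∑ {n} λ v → 𝟙 (arc? D u v) * f v) ≡⟨ over-steps (λ _ v → f v) ⟩
  sumSteps (λ u v → f v) (steps ws) ≡⟨ +-cancelʳ-≡ (f (Vec.head ws)) _ _
    (trans (telescope f ws) (cong (λ w → sumSteps (λ u v → f u) (steps ws) + f w) closed)) ⟩
  sumSteps (λ u v → f u) (steps ws) ≡⟨ over-steps (λ u _ → f u) ⟨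
  ∑ {n} (λ u → ∑ {n} λ v → 𝟙 (arc? D u v) * f u) ∎
  where
  open ≡-Reasoning
  indicator : ∀ u v → 𝟙 (arc? D u v) ≡ count (steps ws) u v
  indicator u v with arc? D u v
  ... | yes a = sym (count-∈ (steps ws) uniq (covers a))
  ... | no ¬a = sym (count-∉ (steps ws) (¬a ∘ step-arc {D = D} ws linked))
  over-steps : ∀ F → ∑ {n} (λ u → ∑ {n} λ v → 𝟙 (arc? D u v) * F u v) ≡ sumSteps F (steps ws)
  over-steps F = trans (∑∑-cong {n} λ u v → cong (_* F u v) (indicator u v)) (sumSteps-count F (steps ws))

-- The distance layers of an Eulerian digraph

tab : (ℕ → ℕ) → ℕ → List ℕ
tab c zero    = c 0 ∷ []
tab c (suc d) = c 0 ∷ tab (c ∘ suc) d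

wsum-tab-∑ : ∀ d (m : Fin n → ℕ → ℕ) g →
             wsum (tab (λ i → ∑ λ u → m u i) d) g ≡ ∑ λ u → wsum (tab (m u) d) g
wsum-tab-∑ {n} zero m g = trans (+-identityʳ _) (trans (Sum.*-distribʳ-sum (g 0) (λ u → m u 0))
  (∑-cong {n} λ u → sym (+-identityʳ _)))
wsum-tab-∑ {n} (suc d) m g = trans
  (cong₂ _+_ (Sum.*-distribʳ-sum (g 0) (λ u → m u 0)) (wsum-tab-∑ d (λ u → m u ∘ suc) (g ∘ suc)))
  (sym (∑-+ {n} _ _))

wsum-tab-0 : ∀ d g → wsum (tab (const 0) d) g ≡ 0
wsum-tab-0 zero    g = refl
wsum-tab-0 (suc d) g = wsum-tab-0 d (g ∘ suc)

wsum-tab-same : ∀ {k d} g → k ≤ d → wsum (tab (same k) d) g ≡ g k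
wsum-tab-same {zero}  {zero}  g _ = trans (+-identityʳ _) (*-identityˡ (g 0))
wsum-tab-same {zero}  {suc d} g _ = trans (cong (1 * g 0 +_) (wsum-tab-0 d (g ∘ suc)))
                                      (trans (+-identityʳ _) (*-identityˡ (g 0)))
wsum-tab-same {suc k} {suc d} g (s≤s k≤d) = wsum-tab-same (g ∘ suc) k≤d

layerSize : (Fin n → ℕ) → ℕ → ℕ
layerSize ℓ i = ∑ λ u → same (ℓ u) i

layers-tab : ∀ {d} {ℓ : Fin n → ℕ} → (∀ u → ℓ u ≤ d) → Layers ℓ (tab (layerSize ℓ) d)
layers-tab {n} {d} {ℓ} h g =
  sym (trans (wsum-tab-∑ d (same ∘ ℓ) g) (∑-cong {n} λ u → wsum-tab-same g (h u)))

linked-tab : ∀ {l} c d → (∀ i → i < d → l ≤ c i * c (suc i)) → Linked (λ a b → l ≤ a * b) (tab c d)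
linked-tab c zero          h = [-]
linked-tab c (suc zero)    h = h 0 (s≤s z≤n) ◂ [-]
linked-tab c (suc (suc d)) h = h 0 (s≤s z≤n) ◂ linked-tab (c ∘ suc) (suc d) (λ i i<d → h (suc i) (s≤s i<d))

argmax : (ℓ : Fin n → ℕ) → Fin n → ∃[ w ] ∀ u → ℓ u ≤ ℓ w
argmax {suc zero}    ℓ _ = Fin.zero , λ { Fin.zero → ≤-refl }
argmax {suc (suc n)} ℓ _ with argmax (ℓ ∘ Fin.suc) Fin.zero
... | w , max with ℓ (Fin.suc w) ≤? ℓ Fin.zero
...   | yes h = Fin.zero , λ { Fin.zero → ≤-refl ; (Fin.suc u) → ≤-trans (max u) h }
...   | no h  = Fin.suc w , λ { Fin.zero → <⇒≤ (≰⇒> h) ; (Fin.suc u) → max u }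

same-no : ∀ {i j} → i ≢ j → same i j ≡ 0
same-no {zero}  {zero}  h = contradiction refl h
same-no {zero}  {suc j} _ = refl
same-no {suc i} {zero}  _ = refl
same-no {suc i} {suc j} h = same-no (h ∘ cong suc)

module Cut (D : Digraph (Fin n)) {ℓ : Fin n → ℕ} (up : ∀ {u v} → Arc D u v → ℓ v ≤ suc (ℓ u)) (i : ℕ) where

  cut : Digraph (Fin n)
  cut = record
    { Arc    = λ u v → Arc D u v × ℓ u ≡ i × ℓ v ≡ suc i
    ; arc?   = λ u v → arc? D u v ×-dec ℓ u ≟ i ×-dec ℓ v ≟ suc i
    ; irrefl = λ u≡v a → Digraph.irrefl D u≡v (proj₁ a)
    }

  size-cut : size cut ≤ layerSize ℓ i * layerSize ℓ (suc i)
  size-cut = ≤-trans (∑∑-mono {n} bound) (≤-reflexive (trans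
    (∑-cong {n} λ u → sym (Sum.*-distribˡ-sum (same (ℓ u) i) (λ v → same (ℓ v) (suc i))))
    (sym (Sum.*-distribʳ-sum (layerSize ℓ (suc i)) (λ u → same (ℓ u) i)))))
    where
    bound : ∀ u v → 𝟙 (arc? cut u v) ≤ same (ℓ u) i * same (ℓ v) (suc i)
    bound u v = 𝟙-≤ (arc? cut u v) λ { (_ , refl , e) → ≤-reflexive (sym
      (cong₂ _*_ (same-refl (ℓ u)) (trans (cong (λ j → same j (suc i)) e) (same-refl (suc i))))) }

  -- Levels rise by at most one per arc, so the first step above level `i` would use an arc of the
  -- cut.
  stuck : ∀ {u v k} → Walk (D ∖ cut) u v k → ℓ u ≤ i → ℓ v ≤ i
  stuck stop h = h
  stuck (_⟶_ {u} {v} (a , ¬c) p) h with ℓ v ≤? i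
  ... | yes h′ = stuck p h′
  ... | no ¬h′ = contradiction (a , u≡i , v≡) ¬c
    where
    u≡i : ℓ u ≡ i
    u≡i = ≤-antisym h (≤-pred (≤-trans (≰⇒> ¬h′) (up a)))
    v≡ : ℓ v ≡ suc i
    v≡ = ≤-antisym (≤-trans (up a) (s≤s h)) (≰⇒> ¬h′)

  cut-bound : ∀ {l u w} → EdgeConnected l D → ℓ u ≤ i → i < ℓ w → l ≤ layerSize ℓ i * layerSize ℓ (suc i)
  cut-bound {u = u} {w} conn u≤i i<w = ≤-trans (conn cut proj₁ ¬strong) size-cut
    where
    ¬strong : ¬ Strong (D ∖ cut)
    ¬strong strong = <⇒≱ i<w (stuck (proj₂ (strong⇒walks strong u w)) u≤i)

module DistanceLayers {l} (D : Digraph (Fin n)) (eulerian : Eulerian D) (conn : EdgeConnected l D)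
                      (v : Fin n) where

  strong : Strong D
  strong = proj₁ eulerian

  ℓ : Fin n → ℕ
  ℓ = dist D strong v

  depth : ℕ
  depth = ℓ (proj₁ (argmax ℓ v))

  layerSizes : List ℕ
  layerSizes = tab (layerSize ℓ) depth

  layers : Layers ℓ layerSizes
  layers = layers-tab {ℓ = ℓ} (proj₂ (argmax ℓ v))

  admissible : Linked (λ a b → l ≤ a * b) layerSizes
  admissible = linked-tab (layerSize ℓ) depth λ i i<d →
    Cut.cut-bound D {ℓ} (dist-arc D strong v) i {u = v} {proj₁ (argmax ℓ v)} conn (≤-trans (≤-reflexive (dist-refl D strong v)) z≤n) i<d

  size≤ : size D + n + 2 * far layerSizes ≤ n * n
  size≤ = Layered.size-bound {ℓ = ℓ} {as = layerSizes} layers D (dist-arc D strong v) (eulerian-balanced D eulerian ℓ)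

  first-layer : layerSize ℓ 0 ≡ 1
  first-layer = trans (∑-cong {n} zero-layer) (∑-δ₁ v)
    where
    walk-0 : ∀ {k u} → Walk D v u k → k ≡ 0 → v ≡ u
    walk-0 stop _ = refl
    zero-layer : ∀ u → same (ℓ u) 0 ≡ δ v u
    zero-layer u with v Fin.≟ u
    ... | yes refl = cong (λ k → same k 0) (dist-refl D strong v)
    ... | no v≢u   = same-no λ e → v≢u (walk-0 (dist-walk D strong v u) e)

-- Distinct common neighbours of u and w give arc-disjoint walks of length 2.
common-neighbours⇒edgeConnected : ∀ {l} (D : Digraph (Fin n)) → Strong D →
  (∀ {u w} → Arc D u w → l ≤ suc (∑ λ z → 𝟙 (arc? D u z ×-dec arc? D z w))) →
  EdgeConnected l D
common-neighbours⇒edgeConnected {n} {l} D strong common S _ ¬strong with l ≤? size S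
... | yes l≤S = l≤S
... | no l≰S  = contradiction (walks⇒strong λ u v → reroute (proj₂ (strong⇒walks strong u v))) ¬strong
  where
  bypass : ∀ {u w} → Arc D u w → ∃ (Walk (D ∖ S) u w)
  bypass {u} {w} a with arc? (D ∖ S) u w | Fin.any? (λ z → arc? (D ∖ S) u z ×-dec arc? (D ∖ S) z w)
  ... | yes b | _               = _ , b ⟶ stop
  ... | no _  | yes (z , b , c) = _ , b ⟶ c ⟶ stop
  ... | no ¬b | no ¬z           = contradiction (≤-trans (common a) (≤-pred blocked)) l≰S
    where
    M : Fin n → Fin n → ℕ
    M x y = 𝟙 (arc? S x y)
    C : Fin n → ℕ
    C z = 𝟙 (arc? D u z ×-dec arc? D z w)
    removed : ∀ {x y} → Arc D x y → ¬ Arc (D ∖ S) x y → M x y ≡ 1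
    removed {x} {y} d ¬d with arc? S x y
    ... | yes s = refl
    ... | no ¬s = contradiction (d , ¬s) ¬d
    -- Every common neighbour loses one of its two arcs. The removed arc from `u` to `w` is charged
    -- at `z = u` and again at `z = w`; this double count is the extra `M u w` in `row+column`.
    pointwise : ∀ z → C z + (δ u z + δ w z) ≤ M u z + M z w
    pointwise z with u Fin.≟ z | w Fin.≟ z
    ... | yes refl | yes refl = contradiction a (Digraph.irrefl D refl)
    ... | yes refl | no _ = ≤-trans
      (≤-reflexive (cong (_+ 1) (𝟙-no (arc? D u u ×-dec arc? D u w) λ (d , _) → Digraph.irrefl D refl d)))
      (≤-trans (≤-reflexive (sym (removed a ¬b))) (m≤n+m (M u w) (M u u)))
    ... | no _ | yes refl = ≤-trans
      (≤-reflexive (cong (_+ 1) (𝟙-no (arc? D u w ×-dec arc? D w w) λ (_ , d) → Digraph.irrefl D refl d)))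
      (≤-trans (≤-reflexive (sym (removed a ¬b))) (m≤m+n (M u w) (M w w)))
    ... | no _ | no _ = ≤-trans (≤-reflexive (+-identityʳ (C z)))
      (𝟙-≤ (arc? D u z ×-dec arc? D z w) λ (d , d′) → hit d d′)
      where
      hit : Arc D u z → Arc D z w → 1 ≤ M u z + M z w
      hit d d′ with arc? (D ∖ S) u z
      ... | no ¬d = ≤-trans (≤-reflexive (sym (removed d ¬d))) (m≤m+n (M u z) (M z w))
      ... | yes e = ≤-trans (≤-reflexive (sym (removed d′ λ e′ → ¬z (z , e , e′)))) (m≤n+m (M z w) (M u z))
    blocked : suc (suc (∑ C)) ≤ suc (size S)
    blocked = begin
      2 + ∑ C                              ≡⟨ +-comm 2 (∑ C) ⟩
      ∑ C + 2                              ≡⟨ cong₂ (λ x y → ∑ C + (x + y)) (∑-δ₁ u) (∑-δ₁ w) ⟨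
      ∑ C + (∑ (δ u) + ∑ (δ w))            ≡⟨ cong (∑ C +_) (∑-+ (δ u) (δ w)) ⟨
      ∑ C + ∑ (λ z → δ u z + δ w z)        ≡⟨ ∑-+ C _ ⟨
      ∑ (λ z → C z + (δ u z + δ w z))      ≤⟨ ∑-mono pointwise ⟩
      ∑ (λ z → M u z + M z w)              ≡⟨ ∑-+ (M u) (λ z → M z w) ⟩
      ∑ (M u) + ∑ (λ z → M z w)            ≤⟨ row+column M u w ⟩
      size S + M u w                       ≤⟨ +-monoʳ-≤ (size S) (𝟙-≤ (arc? S u w) λ _ → ≤-refl) ⟩
      size S + 1                           ≡⟨ +-comm (size S) 1 ⟩
      suc (size S)                         ∎
      where open ≤-Reasoning
  reroute : ∀ {u v k} → Walk D u v k → ∃ (Walk (D ∖ S) u v)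
  reroute stop    = _ , stop
  reroute (a ⟶ p) = _ , proj₂ (bypass a) ⟶⟶ proj₂ (reroute p)

-- A closed trail with symmetric arc set is grown by inserting u → v → u at a
-- visited vertex u; both arcs are new as soon as one of them is.
module SymmetricCircuit (D : Digraph (Fin n)) (arc-sym : ∀ {u v} → Arc D u v → Arc D v u) (r : Fin n) where

  Pairs : Set
  Pairs = List (Fin n × Fin n)

  _∈?_ : (e : Fin n × Fin n) (es : Pairs) → Dec (e ∈ᴸ es)
  _∈?_ = DecMembership._∈?_ (≡-dec Fin._≟_ Fin._≟_)

  data Trail : Fin n → Fin n → Pairs → Set where
    stop : ∀ {u} → Trail u u []
    _⟶_  : ∀ {u v w es} → Arc D u v → Trail v w es → Trail u w ((u , v) ∷ es)

  Visited : Fin n → Pairs → Fin n → Set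
  Visited s es u = u ≡ s ⊎ ∃[ x ] (x , u) ∈ᴸ es

  insert : ∀ {s t es u v} → Trail s t es → Visited s es u → Arc D u v →
           ∃[ es′ ] Trail s t es′ × (u , v) ∷ (v , u) ∷ es ↭ es′
  insert t (inj₁ refl) a = _ , (a ⟶ (arc-sym a ⟶ t)) , ↭-refl
  insert (b ⟶ t) (inj₂ (x , LAny.here refl)) a with insert t (inj₁ refl) a
  ... | _ , t′ , perm = _ , (b ⟶ t′) , ↭-trans (↭-trans (↭-prep _ (↭-swap _ _ ↭-refl)) (↭-swap _ _ ↭-refl)) (↭-prep _ perm)
  insert (b ⟶ t) (inj₂ (x , LAny.there e∈)) a with insert t (inj₂ (x , e∈)) a
  ... | _ , t′ , perm = _ , (b ⟶ t′) , ↭-trans (↭-trans (↭-prep _ (↭-swap _ _ ↭-refl)) (↭-swap _ _ ↭-refl)) (↭-prep _ perm)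

  record State (es : Pairs) : Set where
    field
      trail  : Trail r r es
      unique : LUnique.Unique es
      symm   : ∀ {u v} → (u , v) ∈ᴸ es → (v , u) ∈ᴸ es

  _⊑_ : Pairs → Pairs → Set
  es ⊑ es′ = ∀ {e} → e ∈ᴸ es → e ∈ᴸ es′

  extendArc : ∀ {es u v} → State es → Visited r es u → Arc D u v →
              ∃[ es′ ] State es′ × es ⊑ es′ × (u , v) ∈ᴸ es′
  extendArc {es} {u} {v} st vis a with (u , v) ∈? es
  ... | yes e∈ = es , st , id , e∈
  ... | no e∉ with insert (State.trail st) vis a
  ...   | es′ , trail′ , perm = es′ , st′ , ∈-resp-↭ perm ∘ LAny.there ∘ LAny.there , ∈-resp-↭ perm (LAny.here refl)
    where
    e⁻∉ : ¬ (v , u) ∈ᴸ es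
    e⁻∉ = e∉ ∘ State.symm st
    fresh : LUnique.Unique ((u , v) ∷ (v , u) ∷ es)
    fresh = ((λ e → Digraph.irrefl D (,-injectiveˡ e) a) LAll.∷ LAll.tabulate λ { x∈ refl → e∉ x∈ })
            LAllPairs.∷ LAll.tabulate (λ { x∈ refl → e⁻∉ x∈ }) LAllPairs.∷ State.unique st
    symm′ : ∀ {x y} → (x , y) ∈ᴸ (u , v) ∷ (v , u) ∷ es → (y , x) ∈ᴸ (u , v) ∷ (v , u) ∷ es
    symm′ (LAny.here refl)              = LAny.there (LAny.here refl)
    symm′ (LAny.there (LAny.here refl)) = LAny.here refl
    symm′ (LAny.there (LAny.there e∈))    = LAny.there (LAny.there (State.symm st e∈))
    st′ : State es′
    st′ = record
      { trail  = trail′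
      ; unique = Permutation.Unique-resp-↭ (setoid (Fin n × Fin n)) (↭⇒↭ₛ perm) fresh
      ; symm   = λ e∈ → ∈-resp-↭ perm (symm′ (∈-resp-↭ (↭-sym perm) e∈))
      }

  extendWalk : ∀ {es u v k} → State es → Visited r es u → Walk D u v k →
               ∃[ es′ ] State es′ × es ⊑ es′ × Visited r es′ v
  extendWalk st vis stop = _ , st , id , vis
  extendWalk st vis (a ⟶ p) with extendArc st vis a
  ... | _ , st′ , sub , e∈ with extendWalk st′ (inj₂ (_ , e∈)) p
  ...   | _ , st″ , sub′ , vis′ = _ , st″ , sub′ ∘ sub , vis′

  module _ (strong : Strong D) where

    cover : (L : Pairs) → ∃[ es ] State es × (∀ {u v} → (u , v) ∈ᴸ L → Arc D u v → (u , v) ∈ᴸ es)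
    cover [] = [] , record { trail = stop ; unique = LAllPairs.[] ; symm = λ () } , λ ()
    cover ((u , v) ∷ L) with cover L | arc? D u v
    ... | es , st , covers | no ¬a = es , st , λ { (LAny.here refl) a → contradiction a ¬a
                                                 ; (LAny.there e∈)    a → covers e∈ a }
    -- Inserting at `u` requires that the trail visits `u`, so a walk from `r` to `u` is inserted
    -- first.
    ... | _ , st , covers | yes a with extendWalk st (inj₁ refl) (proj₂ (strong⇒walks strong r u))
    ...   | _ , st′ , sub , vis with extendArc st′ vis a
    ...     | es , st″ , sub′ , uv∈ = es , st″ , λ { (LAny.here refl) _ → uv∈
                                                  ; (LAny.there e∈)    b → sub′ (sub (covers e∈ b)) }

    vertices : ∀ {s t es} → Trail s t es → Vec (Fin n) (length es)
    vertices stop              = Vec.[]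
    vertices (_⟶_ {v = v} a t) = v Vec.∷ vertices t

    steps-vertices : ∀ {s t es} (t : Trail s t es) → steps (s Vec.∷ vertices t) ≡ Vec.fromList es
    steps-vertices stop    = refl
    steps-vertices (a ⟶ t) = cong (_ Vec.∷_) (steps-vertices t)

    linked-vertices : ∀ {s t es} (t : Trail s t es) → VLinked.Linked (Arc D) (s Vec.∷ vertices t)
    linked-vertices stop    = VLinked.[-]
    linked-vertices (a ⟶ t) = a VLinked.∷ linked-vertices t

    last-vertices : ∀ {s t es} (tr : Trail s t es) → Vec.last (s Vec.∷ vertices tr) ≡ t
    last-vertices stop    = refl
    last-vertices (a ⟶ t) = last-vertices t

    unique-fromList : ∀ {es : Pairs} → LUnique.Unique es → AllPairs.AllPairs _≢_ (Vec.fromList es)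
    unique-fromList LAllPairs.[]       = AllPairs.[]
    unique-fromList (e LAllPairs.∷ es) = VAll.fromList⁺ e AllPairs.∷ unique-fromList es

    eulerian : Eulerian D
    eulerian with cover (cartesianProduct (allFin n) (allFin n))
    ... | es , st , covers = strong , length es , r Vec.∷ vertices t ,
      (linked-vertices t , refl , last-vertices t) ,
      subst (AllPairs.AllPairs _≢_) (sym (steps-vertices t)) (unique-fromList (State.unique st)) ,
      λ {u} {v} a → subst ((u , v) ∈_) (sym (steps-vertices t))
        (VMembership.∈-fromList⁺ (covers (∈-cartesianProduct⁺ (∈-allFin u) (∈-allFin v)) a))
      where
      t = State.trail st

-- Layered graphs and path-complete graphs

term≤∑ : (f : Fin n → ℕ) (u : Fin n) → f u ≤ ∑ f
term≤∑ f Fin.zero    = m≤m+n _ _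
term≤∑ f (Fin.suc u) = ≤-trans (term≤∑ (f ∘ Fin.suc) u) (m≤n+m _ _)

positive-term : (f : Fin n → ℕ) → 1 ≤ ∑ f → ∃[ u ] 1 ≤ f u
positive-term {suc n} f h with f Fin.zero in eq
... | suc k = Fin.zero , ≤-trans (s≤s z≤n) (≤-reflexive (sym eq))
... | zero  = let u , 1≤fu = positive-term (f ∘ Fin.suc) h in Fin.suc u , 1≤fu

nth : List ℕ → ℕ → ℕ
nth []       i       = 0
nth (x ∷ xs) zero    = x
nth (x ∷ xs) (suc i) = nth xs i

wsum-0 : ∀ xs → wsum xs (const 0) ≡ 0
wsum-0 []       = refl
wsum-0 (x ∷ xs) = cong₂ _+_ (*-zeroʳ x) (wsum-0 xs)

wsum-same : ∀ xs i → wsum xs (λ k → same k i) ≡ nth xs i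
wsum-same []       i       = refl
wsum-same (x ∷ xs) zero    = trans (cong₂ _+_ (*-identityʳ x) (wsum-0 xs)) (+-identityʳ x)
wsum-same (x ∷ xs) (suc i) = cong₂ _+_ (*-zeroʳ x) (wsum-same xs i)

linked-nth : ∀ {l xs} i → Linked (λ a b → l ≤ a * b) xs → 1 ≤ nth xs (suc i) → l ≤ nth xs i * nth xs (suc i)
linked-nth zero    (h ◂ _)  _ = h
linked-nth (suc i) (_ ◂ hs) h = linked-nth i hs h

same-yes : ∀ {i j} → 1 ≤ same i j → i ≡ j
same-yes {zero}  {zero}  _ = refl
same-yes {suc i} {suc j} h = cong suc (same-yes h)

In : ℕ → ℕ → Set
In k i = k ≡ i ⊎ k ≡ suc i

in-near : ∀ {k k′ i} → In k i → In k′ i → k′ ≤ suc k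
in-near (inj₁ refl) (inj₁ refl) = n≤1+n _
in-near (inj₁ refl) (inj₂ refl) = ≤-refl
in-near (inj₂ refl) (inj₁ refl) = ≤-trans (n≤1+n _) (n≤1+n _)
in-near (inj₂ refl) (inj₂ refl) = n≤1+n _

same₂≤ : ∀ {m} k i → (In k i → 1 ≤ m) → same k i + same k (suc i) ≤ m
same₂≤ k i f with k ≟ i | k ≟ suc i
... | yes refl | yes e    = contradiction (sym e) 1+n≢n
... | yes refl | no ne    = ≤-trans (≤-reflexive (cong₂ _+_ (same-refl k) (same-no ne))) (f (inj₁ refl))
... | no ne    | yes refl = ≤-trans (≤-reflexive (cong₂ _+_ (same-no ne) (same-refl k))) (f (inj₂ refl))
... | no ne    | no ne′   = ≤-trans (≤-reflexive (cong₂ _+_ (same-no ne) (same-no ne′))) z≤n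

handshake : (G : Graph (Fin n)) → 2 * graphSize G ≡ size (bidirected G)
handshake {n} G = trans (cong (graphSize G +_) (trans (+-identityʳ _) (Sum.∑-comm {n} {n} _)))
  (trans (sym (∑∑-+ {n} _ _)) (∑∑-cong {n} pointwise))
  where
  pointwise : ∀ u v → 𝟙 ((u Fin.<? v) ×-dec adj? G u v) + 𝟙 ((v Fin.<? u) ×-dec adj? G v u) ≡ 𝟙 (adj? G u v)
  pointwise u v with adj? G u v
  ... | no ¬a = cong₂ _+_ (𝟙-no ((u Fin.<? v) ×-dec no ¬a) (¬a ∘ proj₂))
                          (𝟙-no ((v Fin.<? u) ×-dec adj? G v u) (¬a ∘ Graph.adj-sym G ∘ proj₂))
  ... | yes a with Fin.<-cmp u v
  ...   | tri< lt _ ¬gt = cong₂ _+_ (𝟙-yes ((u Fin.<? v) ×-dec yes a) (lt , a))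
                                    (𝟙-no ((v Fin.<? u) ×-dec adj? G v u) (¬gt ∘ proj₁))
  ...   | tri≈ _ e _    = contradiction a (Graph.irrefl G e)
  ...   | tri> ¬lt _ gt = cong₂ _+_ (𝟙-no ((u Fin.<? v) ×-dec yes a) (¬lt ∘ proj₁))
                                    (𝟙-yes ((v Fin.<? u) ×-dec adj? G v u) (gt , Graph.adj-sym G a))

-- A coordinate form of an isomorphism with `completeSum as`: distinct vertices are adjacent exactly
-- if their levels differ by at most 1.
record Layering (G : Graph (Fin n)) (as : List ℕ) : Set where
  field
    ℓ      : Fin n → ℕ
    layers : Layers ℓ as
    near   : ∀ {u v} → Adj G u v → ℓ v ≤ suc (ℓ u)
    adj    : ∀ {u v} → u ≢ v → ℓ v ≤ suc (ℓ u) → ℓ u ≤ suc (ℓ v) → Adj G u v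

  distinct : ∀ {u v} → Adj G u v → u ≢ v
  distinct a e = Graph.irrefl G e a

  -- Each ordered pair of vertices is equal, adjacent or apart. For fixed order, a larger size
  -- therefore means a smaller `far`.
  size-equation : 2 * graphSize G + n + 2 * far as ≡ n * n
  size-equation = trans (cong (λ s → s + n + 2 * far as) (handshake G))
    (Layered.size-exact {ℓ = ℓ} {as} layers (bidirected G)
      (λ a → distinct a , near a , near (Graph.adj-sym G a)) adj)

  layerSize≡ : ∀ i → layerSize ℓ i ≡ nth as i
  layerSize≡ i = trans (layers λ k → same k i) (wsum-same as i)

  occupied : ∀ u → 1 ≤ nth as (ℓ u)
  occupied u = ≤-trans (≤-reflexive (sym (same-refl (ℓ u))))
    (≤-trans (term≤∑ (λ x → same (ℓ x) (ℓ u)) u) (≤-reflexive (layerSize≡ (ℓ u))))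

  member : ∀ i → 1 ≤ nth as i → ∃[ u ] ℓ u ≡ i
  member i h = let u , h′ = positive-term (λ u → same (ℓ u) i) (≤-trans h (≤-reflexive (sym (layerSize≡ i))))
               in u , same-yes h′

-- Strength, Eulerian circuits and edge-connectivity of layered graphs

module Connectivity (p : ℕ) (1≤p : 1 ≤ p) (p≤2 : p ≤ 2) (G : Graph (Fin n)) {x y xs}
                    (L : Layering G (x ∷ y ∷ xs)) (adm : Sequences.Adm p 1≤p p≤2 (x ∷ y ∷ xs)) where
  open Sequences p 1≤p p≤2
  open Layering L

  as : List ℕ
  as = x ∷ y ∷ xs

  D : Digraph (Fin n)
  D = bidirected G

  reverse : ∀ {u v k} → Walk D u v k → ∃ (Walk D v u)
  reverse stop    = _ , stop
  reverse (a ⟶ w) = _ , snoc (proj₂ (reverse w)) (Graph.adj-sym G a)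

  root : Fin n
  root = proj₁ (member 0 (posˡ x y (Linked.head adm)))

  ℓ-root : ℓ root ≡ 0
  ℓ-root = proj₂ (member 0 (posˡ x y (Linked.head adm)))

  to-root : ∀ k u → ℓ u ≡ k → ∃ (Walk D u root)
  to-root zero u e with u Fin.≟ root
  ... | yes refl = _ , stop
  ... | no ne    = _ , adj ne (≤-trans (≤-reflexive ℓ-root) z≤n) (≤-trans (≤-reflexive e) z≤n) ⟶ stop
  to-root (suc k) u e with member k (posˡ (nth as k) (nth as (suc k)) (linked-nth k adm below))
    where
    below : 1 ≤ nth as (suc k)
    below = subst (λ j → 1 ≤ nth as j) e (occupied u)
  ... | v , e′ with to-root k v e′
  ...   | _ , w = _ , adj (λ u≡v → 1+n≢n (trans (sym e) (trans (cong ℓ u≡v) e′)))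
                          (≤-trans (≤-reflexive e′) (≤-trans (n≤1+n k) (≤-trans (≤-reflexive (sym e)) (n≤1+n _))))
                          (≤-reflexive (trans e (cong suc (sym e′)))) ⟶ w

  strong : Strong D
  strong = walks⇒strong λ u v →
    _ , proj₂ (to-root (ℓ u) u refl) ⟶⟶ proj₂ (reverse (proj₂ (to-root (ℓ v) v refl)))

  eulerian : Eulerian D
  eulerian = SymmetricCircuit.eulerian D (Graph.adj-sym G) root strong

  -- An edge inside a layer is assigned to that layer and the previous one; only in layer 0 is the
  -- next layer taken instead.
  consecutive : ∀ {u w} → Adj G u w → ∃[ i ] In (ℓ u) i × In (ℓ w) i × 1 ≤ nth as (suc i)
  consecutive {u} {w} a with <-cmp (ℓ u) (ℓ w)
  ... | tri< lt _ _ = ℓ u , inj₁ refl , inj₂ w≡ , subst (λ j → 1 ≤ nth as j) w≡ (occupied w)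
    where w≡ = ≤-antisym (near a) lt
  ... | tri> _ _ gt = ℓ w , inj₂ u≡ , inj₁ refl , subst (λ j → 1 ≤ nth as j) u≡ (occupied u)
    where u≡ = ≤-antisym (near (Graph.adj-sym G a)) gt
  ... | tri≈ _ e _ with ℓ u in eq
  ...   | zero  = 0 , inj₁ refl , inj₁ (sym e) , posʳ x y (Linked.head adm)
  ...   | suc j = j , inj₂ refl , inj₂ (sym e) , subst (λ k → 1 ≤ nth as k) eq (occupied u)

  -- The two layers around the edge form a clique of at least `2 + p` vertices, and all but the two
  -- ends are common neighbours.
  common : ∀ {u w} → Adj G u w → suc p ≤ suc (∑ λ z → 𝟙 (arc? D u z ×-dec arc? D z w))
  common {u} {w} a with consecutive a
  ... | i , u∈ , w∈ , pos = ≤-pred (≤-trans (*⇒+ (nth as i) (nth as (suc i)) (linked-nth i adm pos)) (begin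
    nth as i + nth as (suc i)                    ≡⟨ cong₂ _+_ (layerSize≡ i) (layerSize≡ (suc i)) ⟨
    layerSize ℓ i + layerSize ℓ (suc i)          ≡⟨ ∑-+ {n} _ _ ⟨
    ∑ (λ z → same (ℓ z) i + same (ℓ z) (suc i))  ≤⟨ ∑-mono {n} pointwise ⟩
    ∑ (λ z → C z + (δ u z + δ w z))              ≡⟨ ∑-+ C _ ⟩
    ∑ C + ∑ (λ z → δ u z + δ w z)                ≡⟨ cong (∑ C +_) (∑-+ (δ u) (δ w)) ⟩
    ∑ C + (∑ (δ u) + ∑ (δ w))                    ≡⟨ cong₂ (λ x y → ∑ C + (x + y)) (∑-δ₁ u) (∑-δ₁ w) ⟩
    ∑ C + 2                                      ≡⟨ +-comm (∑ C) 2 ⟩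
    suc (suc (∑ C))                              ∎))
    where
    open ≤-Reasoning
    C : Fin n → ℕ
    C z = 𝟙 (arc? D u z ×-dec arc? D z w)
    pointwise : ∀ z → same (ℓ z) i + same (ℓ z) (suc i) ≤ C z + (δ u z + δ w z)
    pointwise z = same₂≤ (ℓ z) i λ z∈ → counted z∈
      where
      counted : In (ℓ z) i → 1 ≤ C z + (δ u z + δ w z)
      counted z∈ with u Fin.≟ z | w Fin.≟ z
      ... | yes _  | _      = ≤-trans (s≤s z≤n) (m≤n+m _ (C z))
      ... | no _   | yes _  = m≤n+m 1 (C z)
      ... | no u≢z | no w≢z = ≤-trans (≤-reflexive (sym (𝟙-yes (arc? D u z ×-dec arc? D z w)
          (adj u≢z (in-near u∈ z∈) (in-near z∈ u∈) , adj (w≢z ∘ sym) (in-near z∈ w∈) (in-near w∈ z∈)))))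
        (m≤m+n (C z) 0)

  edgeConnected : EdgeConnected (suc p) D
  edgeConnected = common-neighbours⇒edgeConnected D strong common

  -- The root has level 0 and each arc raises the level by at most 1, so a distance from the root is
  -- at least the level reached.
  σ≤dist : (s : Strong D) → σ as ≤ ∑ (dist D s root)
  σ≤dist s = ≤-trans (≤-reflexive (sym (Layered.total {ℓ = ℓ} {as} layers))) (∑-mono {n} λ w →
    ≤-trans (climb {ℓ = ℓ} near (dist-walk D s root w))
      (≤-reflexive (trans (cong (dist D s root w +_) ℓ-root) (+-identityʳ _))))

-- Realising sequential sums on initial segments

Blocks : List ℕ → Set
Blocks as = Σ[ i ∈ Fin (length as) ] Fin (lookup as i)

toBlocks : ∀ as → Fin (sum as) → Blocks as
toBlocks (x ∷ xs) k = [ (Fin.zero ,_) , (λ j → let i , y = toBlocks xs j in Fin.suc i , y) ]′ (Fin.splitAt x k)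

fromBlocks : ∀ as → Blocks as → Fin (sum as)
fromBlocks (x ∷ xs) (Fin.zero  , y) = y ↑ˡ sum xs
fromBlocks (x ∷ xs) (Fin.suc i , y) = x ↑ʳ fromBlocks xs (i , y)

toBlocks-fromBlocks : ∀ as b → toBlocks as (fromBlocks as b) ≡ b
toBlocks-fromBlocks (x ∷ xs) (Fin.zero  , y) rewrite Fin.splitAt-↑ˡ x y (sum xs) = refl
toBlocks-fromBlocks (x ∷ xs) (Fin.suc i , y)
  rewrite Fin.splitAt-↑ʳ x (sum xs) (fromBlocks xs (i , y)) | toBlocks-fromBlocks xs (i , y) = refl

fromBlocks-toBlocks : ∀ as k → fromBlocks as (toBlocks as k) ≡ k
fromBlocks-toBlocks (x ∷ xs) k with Fin.splitAt x k in eq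
... | inj₁ y = Fin.splitAt⁻¹-↑ˡ eq
... | inj₂ j = trans (cong (x ↑ʳ_) (fromBlocks-toBlocks xs j)) (Fin.splitAt⁻¹-↑ʳ eq)

blocks↔ : ∀ as → Fin (sum as) ↔ Blocks as
blocks↔ as = mk↔ₛ′ (toBlocks as) (fromBlocks as) (toBlocks-fromBlocks as) (fromBlocks-toBlocks as)

∑-↑ : ∀ x {m} (f : Fin (x + m) → ℕ) → ∑ f ≡ ∑ (λ i → f (i ↑ˡ m)) + ∑ (λ j → f (x ↑ʳ j))
∑-↑ zero    f = refl
∑-↑ (suc x) f = trans (cong (f Fin.zero +_) (∑-↑ x (f ∘ Fin.suc))) (sym (+-assoc (f Fin.zero) _ _))

block : ∀ as → Blocks as → ℕ
block as (i , _) = toℕ i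

layers-blocks : ∀ as → Layers (block as ∘ toBlocks as) as
layers-blocks []       g = refl
layers-blocks (x ∷ xs) g = trans (∑-↑ x _) (cong₂ _+_
  (trans (∑-cong {x} λ i → cong (g ∘ block (x ∷ xs)) (toBlocks-fromBlocks (x ∷ xs) (Fin.zero , i))) (∑-const x (g 0)))
  (trans (∑-cong {sum xs} λ j → cong (λ s → g (block (x ∷ xs) ([ (Fin.zero ,_) , _ ]′ s))) (Fin.splitAt-↑ʳ x (sum xs) j))
         (layers-blocks xs (g ∘ suc))))

layering : (G : Graph (Fin n)) (as : List ℕ) → G ≅ completeSum as → Layering G as
layering {n} G as (f , adj⇔) = record
  { ℓ      = ℓ
  ; layers = λ g → sym (trans (sym (layers-blocks as g))
               (trans (Sum.sum-permute (g ∘ block as ∘ toBlocks as) (↔-trans f (↔-sym (blocks↔ as))))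
                 (∑-cong {n} λ u → cong (g ∘ block as) (toBlocks-fromBlocks as (Inverse.to f u)))))
  ; near   = λ {u} {v} a → near (Equivalence.to (adj⇔ u v) a)
  ; adj    = λ {u} {v} u≢v h h′ → Equivalence.from (adj⇔ u v)
               (adjacent (u≢v ∘ injective) h h′)
  }
  where
  ℓ : Fin n → ℕ
  ℓ = block as ∘ Inverse.to f
  injective : ∀ {u v} → Inverse.to f u ≡ Inverse.to f v → u ≡ v
  injective {u} {v} e = trans (sym (Inverse.strictlyInverseʳ f u))
    (trans (cong (Inverse.from f) e) (Inverse.strictlyInverseʳ f v))
  near : ∀ {b c} → Adj (completeSum as) b c → block as c ≤ suc (block as b)
  near (within _)   = n≤1+n _
  near (forward e)  = ≤-reflexive e
  near (backward e) = ≤-trans (n≤1+n _) (≤-trans (≤-reflexive (sym e)) (n≤1+n _))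
  adjacent : ∀ {b c} → b ≢ c → block as c ≤ suc (block as b) → block as b ≤ suc (block as c) → Adj (completeSum as) b c
  adjacent {i , y} {j , z} b≢c h h′ with toℕ j ≟ suc (toℕ i) | toℕ i ≟ suc (toℕ j)
  ... | yes e | _     = forward e
  ... | no _  | yes e = backward e
  ... | no ¬e | no ¬e′ with Fin.toℕ-injective (≤-antisym (≤-pred (≤∧≢⇒< h′ ¬e′)) (≤-pred (≤∧≢⇒< h ¬e)))
  ...   | refl = within λ { refl → b≢c refl }

realiseSum : ∀ as → sum as ≡ n → Σ[ G ∈ Graph (Fin n) ] G ≅ completeSum as
realiseSum as refl = G , blocks↔ as , λ _ _ → mk⇔ id id
  where
  G : Graph (Fin (sum as))
  G = record
    { Adj     = λ u v → Adj (completeSum as) (toBlocks as u) (toBlocks as v)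
    ; adj?    = λ u v → adj? (completeSum as) (toBlocks as u) (toBlocks as v)
    ; irrefl  = λ { refl → Graph.irrefl (completeSum as) refl }
    ; adj-sym = Graph.adj-sym (completeSum as)
    }

module PathCompleteSequences (p : ℕ) (1≤p : 1 ≤ p) (p≤2 : p ≤ 2) where
  open Sequences p 1≤p p≤2

  canon⇒adm : ∀ {cs} → Canon cs → ∃[ x ] ∃[ y ] ∃[ zs ] cs ≡ x ∷ y ∷ zs × Adm cs
  canon⇒adm (two a b h)       = a , b , [] , refl , h ◂ [-]
  canon⇒adm (three a b h h′)  = 1 , a , b ∷ [] , refl ,
    ≤-trans h (m≤m+n a 0) ◂ ≤-trans h (m≤m*n a b {{>-nonZero h′}}) ◂ [-]
  canon⇒adm (extra a e h)     = 2 , a , 1 ∷ [] , refl ,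
    ≤-trans p+1≤a (m≤m+n a _) ◂ ≤-trans p+1≤a (≤-reflexive (sym (*-identityʳ a))) ◂ [-]
    where p+1≤a = ≤-trans (≤-reflexive (cong suc e)) h
  canon⇒adm (step c) with canon⇒adm c
  ... | x , y , zs , refl , adm = 1 , suc p , x ∷ y ∷ zs , refl ,
    m≤m+n (suc p) 0 ◂ m≤m*n (suc p) x {{>-nonZero (posˡ x y (Linked.head adm))}} ◂ adm

  -- This excludes exactly the canonical sequences that are not path-complete:
  -- types (i) and (iii) with k = 0.
  Proper : List ℕ → Set
  Proper cs = Canon cs × sum cs ≤ σ cs

  proper-head : ∀ {cs} → Proper cs → ∃[ ys ] cs ≡ 1 ∷ ys
  proper-head (two a b h , le)   = contradiction (+-cancelʳ-≤ (b + 0) a 0 (≤-trans le (≤-reflexive (+-identityʳ _)))) (<⇒≱ (posˡ a b h))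
  proper-head (three a b _ _ , _) = _ , refl
  proper-head (extra a _ _ , le) = contradiction (≤-trans (≤-trans (≤-reflexive (arith a)) le) (≤-reflexive (arith′ a))) 1+n≰n
    where
    arith : ∀ a → suc (a + 2) ≡ 2 + (a + 1)
    arith = solve-∀
    arith′ : ∀ a → a + 1 + (1 + 0) ≡ a + 2
    arith′ = solve-∀
  proper-head (step _ , _) = _ , refl

  step-proper : ∀ {cs} → Canon cs → Proper (1 ∷ suc p ∷ cs)
  step-proper {cs} c = step c , ≤-trans (≤-reflexive (+-comm 1 _))
    (+-monoʳ-≤ (suc p + sum cs) (≤-trans (canon-sum c) (m≤m+n _ (σ cs))))

  three-proper : ∀ {a b} → suc p ≤ a → 1 ≤ b → Proper (1 ∷ a ∷ b ∷ [])
  three-proper {a} {b} h h′ = three a b h h′ , ≤-trans (≤-reflexive (+-comm 1 _))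
    (+-monoʳ-≤ (a + (b + 0)) (≤-trans h′ (≤-trans (m≤m+n b 0) (m≤m+n (b + 0) 0))))

  prefix : ℕ → List ℕ → List ℕ
  prefix k cs = ([K₁+K suc p ]^ k) ++ cs

  prefix-canon : ∀ k {cs} → Canon cs → Canon (prefix k cs)
  prefix-canon zero    c = c
  prefix-canon (suc k) c = step (prefix-canon k c)

  prefix-step : ∀ k cs → prefix k (1 ∷ suc p ∷ cs) ≡ prefix (suc k) cs
  prefix-step zero    cs = refl
  prefix-step (suc k) cs = cong (λ xs → 1 ∷ suc p ∷ xs) (prefix-step k cs)

  pathComplete⇒proper : ∀ {G : Graph (Fin n)} → PathComplete (suc p) G → ∃[ cs ] Proper cs × G ≅ completeSum cs
  pathComplete⇒proper (type-i (suc k) a b _ _ _ h iso)  = _ , step-proper (prefix-canon k (two a b h)) , iso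
  pathComplete⇒proper (type-ii zero a b _ 1≤b h iso)    = _ , three-proper h 1≤b , iso
  pathComplete⇒proper (type-ii (suc k) a b _ 1≤b h iso) = _ , step-proper (prefix-canon k (three a b h 1≤b)) , iso
  pathComplete⇒proper (type-iii (suc k) a refl _ h iso) = _ , step-proper (prefix-canon k (extra a refl h)) , iso

  -- `k` counts the prefixes already split off. As soon as there is one, all canonical types are
  -- path-complete; for `k = 0` properness excludes the exceptions.
  canon⇒pathComplete : ∀ {G : Graph (Fin n)} {cs} k → Canon cs → 1 ≤ k ⊎ Proper cs →
                       G ≅ completeSum (prefix k cs) → PathComplete (suc p) G
  canon⇒pathComplete k (two a b h) (inj₁ 1≤k) iso = type-i k a b 1≤k (posˡ a b h) (posʳ a b h) h iso
  canon⇒pathComplete k (two a b h) (inj₂ q) iso with proper-head q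
  ... | _ , refl = contradiction (+-cancelʳ-≤ (b + 0) 1 0 (≤-trans (proj₂ q) (≤-reflexive (+-identityʳ _)))) λ ()
  canon⇒pathComplete k (three a b h h′) _ iso = type-ii k a b (≤-trans (s≤s z≤n) h) h′ h iso
  canon⇒pathComplete k (extra a refl h) (inj₁ 1≤k) iso = type-iii k a refl 1≤k h iso
  canon⇒pathComplete k (extra a _ h) (inj₂ q) iso with proper-head q
  ... | _ , ()
  canon⇒pathComplete {G = G} k (step {cs} c) _ iso =
    canon⇒pathComplete (suc k) c (inj₁ (s≤s z≤n)) (subst (λ as → G ≅ completeSum as) (prefix-step k cs) iso)

-- Comparison of remoteness

/-mono : ∀ {a b} d .{{_ : NonZero d}} → a ≤ b → (ℤ.+ a) ℚ./ d ℚ.≤ (ℤ.+ b) ℚ./ d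
/-mono {a} {b} (suc d) a≤b = ℚ.toℚᵘ-cancel-≤ (begin
  ℚ.toℚᵘ ((ℤ.+ a) ℚ./ suc d)  ≃⟨ ℚ.toℚᵘ-fromℚᵘ (ℚᵘ.mkℚᵘ (ℤ.+ a) d) ⟩
  ℚᵘ.mkℚᵘ (ℤ.+ a) d           ≤⟨ ℚᵘ.*≤* (ℤ.*-monoʳ-≤-nonNeg (ℤ.+ suc d) (ℤ.+≤+ a≤b)) ⟩
  ℚᵘ.mkℚᵘ (ℤ.+ b) d           ≃⟨ ℚ.toℚᵘ-fromℚᵘ (ℚᵘ.mkℚᵘ (ℤ.+ b) d) ⟨
  ℚ.toℚᵘ ((ℤ.+ b) ℚ./ suc d)  ∎)
  where open ℚᵘ.≤-Reasoning

module ℚ-Extrema = Extrema (DecTotalOrder.totalOrder ℚ.≤-decTotalOrder)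

module _ .{{_ : NonTrivial n}} (D E : Digraph (Fin n)) (sD : Strong D) (sE : Strong E) where

  average-mono : ∀ v r → ∑ (dist D sD v) ≤ ∑ (dist E sE r) →
                 averageDistance D sD v ℚ.≤ averageDistance E sE r
  average-mono v r h = /-mono {∑ (dist D sD v)} {∑ (dist E sE r)} (pred n) h

  remoteness-mono : ∀ r → (∀ v → ∑ (dist D sD v) ≤ ∑ (dist E sE r)) → remoteness D sD ℚ.≤ remoteness E sE
  remoteness-mono r h = ℚ-Extrema.max≤v⁺ (ℚ-Extrema.⊥≤max ℚ.0ℚ averages)
    (LAll.map⁺ below)
    where
    averages : List ℚ.ℚ
    averages = List.map (averageDistance E sE) (allFin n)
    attained : LAll.All (λ v → averageDistance E sE v ℚ.≤ remoteness E sE) (allFin n)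
    attained = LAll.map⁻ (ℚ-Extrema.xs≤max ℚ.0ℚ averages)
    below : LAll.All (λ v → averageDistance D sD v ℚ.≤ remoteness E sE) (allFin n)
    below = LAll.tabulate λ {v} _ → ℚ.≤-trans (average-mono v r (h v)) (LAll.lookup attained (∈-allFin r))

-- The bound and its sharpness

module _ (p : ℕ) (1≤p : 1 ≤ p) (p≤2 : p ≤ 2) {n m₀ : ℕ} .{{_ : NonTrivial n}} (PK : Graph (Fin n))
         (isMinimum : IsMinimumPathComplete (suc p) n m₀ PK) where
  open Sequences p 1≤p p≤2
  open PathCompleteSequences p 1≤p p≤2

  private
    PK-sequence = pathComplete⇒proper (proj₁ isMinimum)

  cs : List ℕ
  cs = proj₁ PK-sequence

  proper : Proper cs
  proper = proj₁ (proj₂ PK-sequence)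

  layeringPK : Layering PK cs
  layeringPK = layering PK cs (proj₂ (proj₂ PK-sequence))

  order≡ : ∀ {G : Graph (Fin n)} {as} → Layering G as → n ≡ sum as
  order≡ {as = as} L = Layered.order {ℓ = Layering.ℓ L} {as} (Layering.layers L)

  -- Both sequences start with 1 and have the same sum, so their weights differ exactly as their
  -- values of `far`. A larger `σ ds` would contradict `canon-mono`.
  proper-σ≤ : ∀ {ds} → Proper ds → sum ds ≡ n → far ds ≤ far cs → σ ds ≤ σ cs
  proper-σ≤ {ds} q sum≡ far≤ = ≮⇒≥ λ lt →
    <⇒≱ (canon-mono (proj₁ proper) (proj₁ q) sums lt) (weights (proper-head proper) (proper-head q))
    where
    sums : sum cs ≡ sum ds
    sums = trans (sym (order≡ layeringPK)) (sym sum≡)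
    weights : ∃[ ys ] cs ≡ 1 ∷ ys → ∃[ zs ] ds ≡ 1 ∷ zs → weight ds ≤ weight cs
    weights (ys , e) (zs , e′) = subst₂ (λ S T → suc p * S + far ds ≤ suc p * T + far cs)
      (cong (sum ∘ drop 1) (sym e′)) (cong (sum ∘ drop 1) (sym e))
      (≤-reflexive (cong (suc p *_) (suc-injective (trans (cong sum (sym e′)) (trans (sym sums) (cong sum e))))) ⊹ far≤)

  module _ (D : Digraph (Fin n)) (eulerian : Eulerian D) (conn : EdgeConnected (suc p) D)
           (2m₀≤ : 2 * m₀ ≤ size D) (v : Fin n) where
    open DistanceLayers D eulerian conn v

    sum-layers : sum layerSizes ≡ n
    sum-layers = sym (Layered.order {ℓ = ℓ} {layerSizes} layers)

    σ-layers : ∑ ℓ ≡ σ layerSizes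
    σ-layers = Layered.total {ℓ = ℓ} {layerSizes} layers

    -- The graph `H` with layers `ds` has at least half the size of `D`, hence at least `m₀` edges.
    -- It competes with `PK`, and minimality of `PK` becomes a bound on `far ds`.
    realised : ∀ ds → Proper ds → sum ds ≡ n → far ds ≤ far layerSizes → far ds ≤ far cs
    realised ds q sum≡ far≤ = *-cancelˡ-≤ 2 (+-cancelˡ-≤ (2 * graphSize H + n) (2 * far ds) (2 * far cs) (begin
      2 * graphSize H + n + 2 * far ds   ≡⟨ Layering.size-equation LH ⟩
      n * n                              ≡⟨ Layering.size-equation layeringPK ⟨
      2 * graphSize PK + n + 2 * far cs  ≤⟨ +-monoˡ-≤ (2 * far cs) (+-monoˡ-≤ n (*-monoʳ-≤ 2 minimal)) ⟩
      2 * graphSize H + n + 2 * far cs   ∎))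
      where
      open ≤-Reasoning
      H = proj₁ (realiseSum ds sum≡)
      iso = proj₂ (realiseSum ds sum≡)
      LH = layering H ds iso
      enough : 2 * m₀ ≤ 2 * graphSize H
      enough = ≤-trans 2m₀≤ (+-cancelʳ-≤ n (size D) (2 * graphSize H)
        (+-cancelʳ-≤ (2 * far ds) (size D + n) (2 * graphSize H + n) (begin
          size D + n + 2 * far ds           ≤⟨ +-monoʳ-≤ (size D + n) (*-monoʳ-≤ 2 far≤) ⟩
          size D + n + 2 * far layerSizes   ≤⟨ size≤ ⟩
          n * n                             ≡⟨ Layering.size-equation LH ⟨
          2 * graphSize H + n + 2 * far ds  ∎)))
      minimal : graphSize PK ≤ graphSize H
      minimal = proj₂ (proj₂ isMinimum) H (canon⇒pathComplete 0 (proj₁ q) (inj₂ q) iso) (*-cancelˡ-≤ 2 enough)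

    better-bound : ∀ as → sum as ≡ n → n ≤ σ as → ∃[ ys ] as ≡ 1 ∷ ys → far as ≤ far layerSizes →
                   Better as → σ as ≤ σ cs
    better-bound as sum≡ n≤ (ys , refl) far≤ (ds , canon , sum-ds , σ-ds , weight≤) = ≤-trans (≤-reflexive (sym σ-ds))
      (proper-σ≤ q (trans sum-ds sum≡) (realised ds q (trans sum-ds sum≡) (≤-trans (far-ds (proper-head q)) far≤)))
      where
      q : Proper ds
      q = canon , ≤-trans (≤-reflexive (trans sum-ds sum≡)) (≤-trans n≤ (≤-reflexive (sym σ-ds)))
      far-ds : ∃[ zs ] ds ≡ 1 ∷ zs → far ds ≤ far as
      far-ds (zs , refl) = +-cancelˡ-≤ (suc p * sum zs) (far ds) (far as)
        (≤-trans weight≤ (≤-reflexive (cong (λ s → suc p * s + far as) (suc-injective (sym sum-ds)))))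

    -- If `σ as ≤ n`, properness of `cs` already gives `n ≤ σ cs`. Otherwise the canonical sequence
    -- that replaces `as` is proper and can be realised.
    σ-bound : ∀ as → Adm as → sum as ≡ n → ∃[ ys ] as ≡ 1 ∷ ys → far as ≤ far layerSizes → σ as ≤ σ cs
    σ-bound _ _ 1≡n ([] , refl) _ = contradiction (nonTrivial⇒n>1 n) (<-irrefl 1≡n)
    σ-bound as adm sum≡ (y ∷ ys , refl) far≤ =
      [ (λ n≤ → better-bound as sum≡ n≤ (y ∷ ys , refl) far≤ (canonicalise n 1 y ys adm (≤-reflexive sum≡)))
      , (λ σ≤ → ≤-trans σ≤ (≤-trans (≤-reflexive (order≡ layeringPK)) (proj₂ proper)))
      ]′ (≤-total n (σ as))

    distance≤ : ∑ ℓ ≤ σ cs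
    distance≤ = ≤-trans (≤-reflexive σ-layers)
      (σ-bound layerSizes admissible sum-layers (first depth) ≤-refl)
      where
      first : ∀ d → ∃[ ys ] tab (layerSize ℓ) d ≡ 1 ∷ ys
      first zero    = _ , cong (_∷ []) first-layer
      first (suc d) = _ , cong (_∷ tab (layerSize ℓ ∘ suc) d) first-layer

  Conclusion : Set₁
  Conclusion = Σ[ strongPK ∈ Strong (bidirected PK) ]
    ((∀ (D : Digraph (Fin n)) (eulerian : Eulerian D) →
    EdgeConnected (suc p) D → 2 * m₀ ≤ size D →
    remoteness D (proj₁ eulerian) ℚ.≤ remoteness (bidirected PK) strongPK)
    ×
    (Σ[ D ∈ Digraph (Fin n) ] Σ[ eulerian ∈ Eulerian D ]
    (EdgeConnected (suc p) D × 2 * m₀ ≤ size D ×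
    remoteness D (proj₁ eulerian) ≡ remoteness (bidirected PK) strongPK)))

  conclude : (e : Eulerian (bidirected PK)) → EdgeConnected (suc p) (bidirected PK) →
             (r : Fin n) → σ cs ≤ ∑ (dist (bidirected PK) (proj₁ e) r) → Conclusion
  conclude e conn r σ≤ =
    proj₁ e ,
    (λ D eulerian conn′ 2m₀≤ → remoteness-mono D (bidirected PK) (proj₁ eulerian) (proj₁ e) r λ v →
      ≤-trans (distance≤ D eulerian conn′ 2m₀≤ v) σ≤) ,
    -- The extremal digraph is the bidirected graph itself, taken with the same proof of strength,
    -- so the two values of the remoteness agree by `refl`.
    bidirected PK , e , conn ,
    ≤-trans (*-monoʳ-≤ 2 (proj₁ (proj₂ isMinimum))) (≤-reflexive (handshake PK)) , refl

  connected : ∃[ x ] ∃[ y ] ∃[ zs ] cs ≡ x ∷ y ∷ zs × Adm cs → Conclusion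
  connected (x , y , zs , cs≡ , adm) =
    conclude C.eulerian C.edgeConnected C.root (≤-trans (≤-reflexive (cong σ cs≡)) (C.σ≤dist (proj₁ C.eulerian)))
    where
    module C = Connectivity p 1≤p p≤2 PK (subst (Layering PK) cs≡ layeringPK) (subst Adm cs≡ adm)

  main : Conclusion
  main = connected (canon⇒adm (proj₁ proper))

theorem4p7 : ∀ (l : ℕ) → l ≡ 2 ⊎ l ≡ 3 →
    ∀ (n m₀ : ℕ) .{{_ : NonTrivial n}} .{{_ : NonZero m₀}} →
    ∀ (PK : Graph (Fin n)) → IsMinimumPathComplete l n m₀ PK →
    Σ[ strongPK ∈ Strong (bidirected PK) ]
    ((∀ (D : Digraph (Fin n)) (eulerian : Eulerian D) →
    EdgeConnected l D → 2 * m₀ ≤ size D →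
    remoteness D (proj₁ eulerian) ℚ.≤ remoteness (bidirected PK) strongPK)
    ×
    (Σ[ D ∈ Digraph (Fin n) ] Σ[ eulerian ∈ Eulerian D ]
    (EdgeConnected l D × 2 * m₀ ≤ size D ×
    remoteness D (proj₁ eulerian) ≡ remoteness (bidirected PK) strongPK)))
theorem4p7 _ (inj₁ refl) n m₀ PK isMinimum = main 1 ≤-refl (s≤s z≤n) PK isMinimum
theorem4p7 _ (inj₂ refl) n m₀ PK isMinimum = main 2 (s≤s z≤n) ≤-refl PK isMinimum
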